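{- Let $G$ be a graph, let $\eta$ be an index function of $G$ with $\eta(e)=1$ for every edge $e\in E(G)$, and let $v$ be a vertex of $G$. Let $S$ be a set of exactly $d_G(v)-\eta(v)$ neighbours of $v$ such that $\eta(u)\ge 1$ for every $u\in S$ (so there remain exactly $\eta(v)$ neighbours of $v$ not in $S$). Let $\eta'$ be the index function of $G-v$ that equals the restriction of $\eta$ to $V(G-v)\cup E(G-v)$, except that $\eta'(u)=\eta(u)-1$ for each $u\in S$, and $\eta'(u)=\eta(u)+1$ for each neighbour $u$ of $v$ with $u\notin S$. If $\eta'$ is a non-singular index function of $G-v$, then $\eta$ is a non-singular index function of $G$.
   Context: Graphs are finite and simple; $d_G(v)$ is the degree of $v$, and $G-v$ is obtained from $G$ by deleting $v$ and all edges incident to $v$. The matrix $A_G$: fix an orientation of $G$. $A_G$ is the real matrix with rows indexed by $E(G)$ and columns indexed by $V(G)\cup E(G)$, where for an edge $e$ oriented from $a$ to $b$: $A_G[e,z]=1$ if $z=b$ or $z\neq e$ is an edge incident to $b$; $A_G[e,z]=-1$ if $z=a$ or $z\ne e$ is an edge incident to $a$; and $A_G[e,z]=0$ otherwise. (Changing the orientation only multiplies rows by $-1$, so the notions below do not depend on it.) $A_G(z)$ denotes the column indexed by $z$. An index function of $G$ is a mapping $\eta$ assigning to each $z\in V(G)\cup E(G)$ a non-negative integer $\eta(z)$. It is valid if $\sum_{z\in V(G)\cup E(G)}\eta(z)=|E(G)|$. $A_G(\eta)$ is the matrix whose columns are columns of $A_G$, with each column $A_G(z)$ occurring exactly $\eta(z)$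 times; for valid $\eta$ it is square. The permanent of an $m\times m$ matrix $A$ is $\mathrm{per}(A)=\sum_{\sigma\in S_m}\prod_{i=1}^m A[i,\sigma(i)]$ (the empty matrix has permanent $1$). An index function $\eta$ of $G$ is non-singular if there is a valid index function $\eta''\le\eta$ (pointwise) with $\mathrm{per}(A_G(\eta''))\neq 0$. -}

module Defs where

open import Data.Bool.Base using (Bool; true; false; T; if_then_else_)
open import Data.Fin.Base as Fin using (Fin; zero; suc; punchIn; cast)
open import Data.Fin.Permutation as Perm
  using (Permutation′; _⟨$⟩ʳ_; insert; remove; insert-remove)
open import Data.Fin.Properties using (_≟_; _<?_; punchIn-cancel-≤; punchIn-injective)
open import Data.Fin.Subset using (Subset; ∣_∣)
open import Data.Fin.Subset.Properties using (_∈?_)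
open import Data.Integer.Base as ℤ using (ℤ; 0ℤ; 1ℤ; -1ℤ)
open import Data.Integer.Properties using (*-1-commutativeMonoid)
open import Data.List.Base
  using (List; []; _∷_; _++_; map; mapMaybe; concatMap; replicate; foldr;
         length; lookup; allFin; cartesianProduct)
open import Data.List.Membership.Propositional using (_∈_)
open import Data.List.Membership.Propositional.Properties
  using (∈-allFin; ∈-cartesianProduct⁺)
open import Data.List.Properties using (length-++; length-replicate)
open import Data.List.Relation.Unary.All as All using (All; []; _∷_; universal)
import Data.List.Relation.Unary.All.Properties as All
open import Data.List.Relation.Unary.AllPairs as AllPairs using (AllPairs; []; _∷_)
import Data.List.Relation.Unary.AllPairs.Properties as AllPairs
open import Data.List.Relation.Unary.Any as Any using (Any; here; there)
import Data.List.Relation.Unary.Any.Properties as Any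
open import Data.List.Relation.Unary.Unique.Propositional using (Unique)
import Data.List.Relation.Unary.Unique.Propositional.Properties as Unique
open import Data.Maybe.Base using (Maybe; just; nothing)
import Data.Maybe.Relation.Unary.All as MAll
import Data.Maybe.Relation.Unary.Any as MAny
open import Data.Nat.Base as ℕ using (ℕ; zero; suc)
import Data.Nat.Properties as ℕ
open import Data.Nat.ListAction using (sum)
open import Data.Product.Base using (Σ-syntax; _×_; _,_)
open import Data.Sum.Base using (_⊎_; inj₁; inj₂)
open import Data.Vec.Base using (tabulate)
open import Relation.Binary.PropositionalEquality
  using (_≡_; _≢_; refl; sym; trans; cong; cong₂; subst)
open import Relation.Nullary.Decidable
  using (Dec; yes; no; does; T?; ¬?; _×-dec_; _⊎-dec_; map′)
open import Relation.Nullary.Negation using (¬_; contradiction-irr)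

import Algebra.Properties.CommutativeMonoid.Sum *-1-commutativeMonoid as Prod

permutations : ∀ m → List (Permutation′ m)
permutations zero    = Perm.id ∷ []
permutations (suc m) =
  concatMap (λ j → map (insert zero j) (permutations m)) (allFin (suc m))

permutations-complete : ∀ {m} (π : Permutation′ m) → Any (Perm._≈ π) (permutations m)
permutations-complete {zero}  π = here λ ()
permutations-complete {suc m} π =
  Any.concatMap⁺ _ (Any.map at-image (∈-allFin (π ⟨$⟩ʳ zero)))
  where
  insert-cong : ∀ j {ρ} → ρ Perm.≈ remove zero π →
                insert zero j ρ Perm.≈ insert zero j (remove zero π)
  insert-cong j ρ≈ zero    = refl
  insert-cong j ρ≈ (suc i) = cong (punchIn j) (ρ≈ i)

  at-image : ∀ {j} → π ⟨$⟩ʳ zero ≡ j →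
             Any (Perm._≈ π) (map (insert zero j) (permutations m))
  at-image refl = Any.map⁺ (Any.map
    (λ {ρ} ρ≈ i → trans (insert-cong (π ⟨$⟩ʳ zero) {ρ} ρ≈ i) (insert-remove zero π i))
    (permutations-complete (remove zero π)))

permutations-distinct : ∀ m → AllPairs (λ π ρ → ¬ π Perm.≈ ρ) (permutations m)
permutations-distinct zero    = [] ∷ []
permutations-distinct (suc m) = AllPairs.concat⁺
  (All.map⁺ (universal same-image (allFin (suc m))))
  (AllPairs.map⁺ (AllPairs.map other-image (Unique.allFin⁺ (suc m))))
  where
  same-image : ∀ j → AllPairs (λ π ρ → ¬ π Perm.≈ ρ) (map (insert zero j) (permutations m))
  same-image j = AllPairs.map⁺ (AllPairs.map
    (λ π≉ρ eq → π≉ρ λ i → punchIn-injective j _ _ (eq (suc i)))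
    (permutations-distinct m))

  other-image : ∀ {j k} → j ≢ k →
    All (λ π → All (λ ρ → ¬ π Perm.≈ ρ) (map (insert zero k) (permutations m)))
        (map (insert zero j) (permutations m))
  other-image j≢k = All.map⁺ (universal
    (λ _ → All.map⁺ (universal (λ _ eq → j≢k (eq zero)) _)) _)

per : ∀ {m} → (Fin m → Fin m → ℤ) → ℤ
per {m} A =
  foldr ℤ._+_ 0ℤ (map (λ σ → Prod.sum (λ i → A i (σ ⟨$⟩ʳ i))) (permutations m))

record Graph (n : ℕ) : Set where
  field
    adj        : Fin n → Fin n → Bool
    adj-sym    : ∀ u w → adj u w ≡ adj w u
    adj-irrefl : ∀ u → adj u u ≡ false

open Graph public

neighbours : ∀ {n} → Graph n → Fin n → Subset n
neighbours G v = tabulate (adj G v)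

degree : ∀ {n} → Graph n → Fin n → ℕ
degree G v = ∣ neighbours G v ∣

-- An edge {lo , hi} is stored with its smaller endpoint first; the proof
-- fields are irrelevant, so edges with equal endpoints are equal.
record Edge {n} (G : Graph n) : Set where
  constructor edge
  field
    lo hi     : Fin n
    .lo<hi    : lo Fin.< hi
    .adjacent : T (adj G lo hi)

open Edge public

module _ {n} {G : Graph n} where

  _∈ₑ_ : Fin n → Edge G → Set
  w ∈ₑ e = w ≡ lo e ⊎ w ≡ hi e

  _∈ₑ?_ : ∀ w e → Dec (w ∈ₑ e)
  w ∈ₑ? e = (w ≟ lo e) ⊎-dec (w ≟ hi e)

  _≟ₑ_ : (e f : Edge G) → Dec (e ≡ f)
  e ≟ₑ f = map′ (λ { (refl , refl) → refl }) (λ { refl → refl , refl })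
                ((lo e ≟ lo f) ×-dec (hi e ≟ hi f))

module _ {n} (G : Graph n) where

  toEdge : Fin n × Fin n → Maybe (Edge G)
  toEdge (u , w) with u <? w | T? (adj G u w)
  ... | yes u<w | yes uw = just (edge u w u<w uw)
  ... | yes _   | no  _  = nothing
  ... | no  _   | _      = nothing

  edges : List (Edge G)
  edges = mapMaybe toEdge (cartesianProduct (allFin n) (allFin n))

  toEdge-endpoints : ∀ p {e} → toEdge p ≡ just e → p ≡ (lo e , hi e)
  toEdge-endpoints (u , w) eq with u <? w | T? (adj G u w) | eq
  ... | yes _ | yes _ | refl = refl
  ... | yes _ | no  _ | ()
  ... | no  _ | _     | ()

  toEdge-complete : ∀ e → toEdge (lo e , hi e) ≡ just e
  toEdge-complete (edge u w u<w uw) with u <? w | T? (adj G u w)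
  ... | yes _   | yes _  = refl
  ... | yes _   | no ¬uw = contradiction-irr uw ¬uw
  ... | no  u≮w | _      = contradiction-irr u<w u≮w

  edges-complete : ∀ e → e ∈ edges
  edges-complete e = Any.mapMaybe⁺ toEdge _ (Any.map⁺ (Any.map
    (λ { refl → subst (MAny.Any (e ≡_)) (sym (toEdge-complete e)) (MAny.just refl) })
    (∈-cartesianProduct⁺ (∈-allFin (lo e)) (∈-allFin (hi e)))))

  edges-unique : Unique edges
  edges-unique = go (Unique.cartesianProduct⁺ (Unique.allFin⁺ n) (Unique.allFin⁺ n))
    where
    avoids : ∀ {p e} → toEdge p ≡ just e → ∀ {q} → p ≢ q → MAll.All (e ≢_) (toEdge q)
    avoids {p} {e} p↦e {q} p≢q with toEdge q in q↦f
    ... | nothing = MAll.nothing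
    ... | just f  = MAll.just λ { refl →
      p≢q (trans (toEdge-endpoints p p↦e) (sym (toEdge-endpoints q q↦f))) }

    go : ∀ {ps} → Unique ps → Unique (mapMaybe toEdge ps)
    go []                     = []
    go {p ∷ ps} (p∉ps ∷ uniq) with toEdge p in p↦e
    ... | nothing = go uniq
    ... | just e  = All.mapMaybe⁺ (All.map⁺ (All.map (avoids p↦e) p∉ps)) ∷ go uniq

  Element : Set
  Element = Fin n ⊎ Edge G

  elements : List Element
  elements = map inj₁ (allFin n) ++ map inj₂ edges

  IndexFunction : Set
  IndexFunction = Element → ℕ

  record Orientation : Set where
    field
      tail head : Edge G → Fin n
      endpoints : ∀ e → (tail e ≡ lo e × head e ≡ hi e)
                      ⊎ (tail e ≡ hi e × head e ≡ lo e)

open Orientation public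

module _ {n} {G : Graph n} where

  Touches : Edge G → Element G → Fin n → Set
  Touches e (inj₁ w) b = w ≡ b
  Touches e (inj₂ f) b = f ≢ e × b ∈ₑ f

  touches? : ∀ e z b → Dec (Touches e z b)
  touches? e (inj₁ w) b = w ≟ b
  touches? e (inj₂ f) b = ¬? (f ≟ₑ e) ×-dec (b ∈ₑ? f)

  -- The entries are 0 and ±1, so the real permanent is computed in ℤ.
  -- No z touches both endpoints of e, so the order of the tests is immaterial.
  A[_] : Orientation G → Edge G → Element G → ℤ
  A[ o ] e z =
    if does (touches? e z (head o e)) then 1ℤ  else
    if does (touches? e z (tail o e)) then -1ℤ else 0ℤ

  Valid : IndexFunction G → Set
  Valid η = sum (map η (elements G)) ≡ length (edges G)

  repeat : IndexFunction G → List (Element G) → List (Element G)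
  repeat η = concatMap (λ z → replicate (η z) z)

  length-repeat : ∀ η zs → length (repeat η zs) ≡ sum (map η zs)
  length-repeat η []       = refl
  length-repeat η (z ∷ zs) = trans (length-++ (replicate (η z) z))
    (cong₂ ℕ._+_ (length-replicate (η z)) (length-repeat η zs))

  columns : IndexFunction G → List (Element G)
  columns η = repeat η (elements G)

  A[_]⟨_⟩ : Orientation G → (η : IndexFunction G) → Valid η →
            Fin (length (edges G)) → Fin (length (edges G)) → ℤ
  A[ o ]⟨ η ⟩ valid i j = A[ o ] (lookup (edges G) i) (lookup (columns η) (cast eq j))
    where
    eq : length (edges G) ≡ length (columns η)
    eq = sym (trans (length-repeat η (elements G)) valid)

  NonSingular : Orientation G → IndexFunction G → Set
  NonSingular o η =
    Σ[ η″ ∈ IndexFunction G ] Σ[ valid ∈ Valid η″ ]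
      (∀ z → η″ z ℕ.≤ η z) × per (A[ o ]⟨ η″ ⟩ valid) ≢ 0ℤ

-- The vertices of G ∖ v are numbered through punchIn v, the increasing
-- enumeration of all vertices other than v.
_∖_ : ∀ {n} → Graph (suc n) → Fin (suc n) → Graph n
G ∖ v = record
  { adj        = λ u w → adj G (punchIn v u) (punchIn v w)
  ; adj-sym    = λ u w → adj-sym G (punchIn v u) (punchIn v w)
  ; adj-irrefl = λ u → adj-irrefl G (punchIn v u)
  }

module _ {n} (G : Graph (suc n)) (v : Fin (suc n)) where

  includeEdge : Edge (G ∖ v) → Edge G
  includeEdge (edge u w u<w uw) = edge (punchIn v u) (punchIn v w)
    (ℕ.≰⇒> λ le → ℕ.<⇒≱ u<w (punchIn-cancel-≤ v w u le)) uw

  -- Only used when η is positive on S ⊆ neighbours G v, so that ∸ 1 does not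
  -- truncate.
  transfer : IndexFunction G → Subset (suc n) → IndexFunction (G ∖ v)
  transfer η S (inj₂ e) = η (inj₂ (includeEdge e))
  transfer η S (inj₁ u) =
    let w = punchIn v u in
    if does (w ∈? S)              then η (inj₁ w) ℕ.∸ 1 else
    if does (w ∈? neighbours G v) then η (inj₁ w) ℕ.+ 1 else
    η (inj₁ w)

{-# OPTIONS --safe #-}
module Submission where

open import Defs
open import Data.Bool.Base using (true; false; if_then_else_)
open import Data.Bool.Properties using (T-≡)
open import Data.Empty using (⊥-elim)
open import Data.Fin.Base as Fin using (Fin; zero; suc; punchIn; punchOut; cast)
open import Data.Fin.Permutation using (Permutation′; _⟨$⟩ʳ_; insert)
open import Data.Fin.Properties
  using (_≟_; _<?_; <-cmp; <-asym; <-irrefl; cast-is-id;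
         punchIn-injective; punchInᵢ≢i; punchIn-punchOut; punchIn-mono-≤)
open import Data.Fin.Subset using (Subset; ∣_∣; _∈_; _⊆_; inside; outside)
open import Data.Fin.Subset.Properties using (_∈?_)
open import Data.Integer.Base as ℤ using (ℤ; 0ℤ; 1ℤ; -1ℤ)
import Data.Integer.Properties as ℤ
import Data.Integer.Tactic.RingSolver as ℤ
open import Data.List.Base
  using (List; []; _∷_; _++_; map; concatMap; replicate; foldr; length; lookup; allFin; tabulate; filter)
open import Data.List.Membership.Propositional using () renaming (_∈_ to _∈ˡ_; _∉_ to _∉ˡ_)
open import Data.List.Membership.Propositional.Properties
  using (∈-∃++; ∈-allFin; ∈-map⁺; ∈-map⁻; ∈-filter⁺; ∈-filter⁻; ∈-++⁺ˡ; ∈-++⁺ʳ)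
open import Data.List.Membership.Propositional.Properties.WithK using (unique∧set⇒bag)
open import Data.List.Properties
  using (++-assoc; filter-all; length-map; map-++; map-∘; map-tabulate; tabulate-cong; tabulate-lookup)
open import Data.List.Relation.Binary.BagAndSetEquality using (∼bag⇒↭)
open import Data.List.Relation.Binary.Permutation.Propositional
  using (_↭_; prep; swap; ↭-refl; ↭-sym; ↭-trans; ↭-swap)
open import Data.List.Relation.Binary.Permutation.Propositional.Properties
  using (↭-length; ++⁺ˡ; shift) renaming (map⁺ to ↭-map⁺)
open import Data.List.Relation.Unary.All as All using (All; []; _∷_)
import Data.List.Relation.Unary.All.Properties as All
open import Data.List.Relation.Unary.AllPairs using ([]; _∷_)
open import Data.List.Relation.Unary.Any as Any using (here; there)
open import Data.List.Relation.Unary.Unique.Propositional using (Unique)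
import Data.List.Relation.Unary.Unique.Propositional.Properties as Unique
open import Data.Nat.Base as ℕ using (ℕ; zero; suc; _+_; _*_; _≤_; z≤n; s≤s)
open import Data.Nat.ListAction using (sum)
open import Data.Nat.ListAction.Properties using (sum-++; sum-↭)
import Data.Nat.Properties as ℕ
import Data.Nat.Tactic.RingSolver as ℕ
open import Data.Product.Base using (Σ-syntax; _×_; _,_; proj₁; proj₂)
open import Data.Sum.Base using (_⊎_; inj₁; inj₂; [_,_]′)
open import Data.Sum.Properties using (≡-dec; inj₁-injective; inj₂-injective)
open import Data.Vec.Base using ([]; _∷_)
open import Data.Vec.Properties using ([]=⇒lookup; lookup⇒[]=; lookup∘tabulate)
open import Function.Base using (_∘_; id)
open import Function.Bundles using (Equivalence; mk⇔)
open import Relation.Binary.Definitions using (DecidableEquality; tri<; tri≈; tri>)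
open import Relation.Binary.PropositionalEquality
open import Relation.Nullary.Decidable using (Dec; yes; no; does; ¬?; T?; recompute)
open import Relation.Nullary.Negation using (¬_)
open import Relation.Unary using (Decidable)

import Algebra.Properties.CommutativeMonoid.Sum ℤ.*-1-commutativeMonoid as Prod

-- The column of an edge is the sum of the columns of its two endpoints. The column of v is
-- supported on the d = d(v) rows of edges at v, so a matrix with more than d copies of it has
-- permanent 0, and prefixing d copies to a matrix for G − v multiplies the permanent by ± d!.
-- Start from d copies of v followed by the columns that witness η′. For u ∉ S, a copy of u may be
-- replaced by the edge uv = u + v at no cost: the difference has d + 1 copies of v. For u ∈ S,
-- v = uv − u shows that some copy of v may be replaced by uv or by u; after these |S| steps only
-- d − |S| = η(v) copies of v are left.

-- The order of the two kinds of exchange matters. The exchange for a neighbour u outside S relies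
-- on d copies of v being present, while each exchange for u in S uses one of them up, so all
-- exchanges of the former kind come before those of the latter. Non-singularity of η′ only supplies
-- some η″ ≤ η′, so the extra copy allowed by η′(u) = η(u) + 1 need not occur; if no copy of u is
-- present, nothing is exchanged for that u. For u in S it is not known in advance whether uv or u
-- will enter. Room for both is therefore kept free from the start: η(uv) = 1 leaves room for the
-- edge and η′(u) = η(u) - 1 for the vertex. Only non-vanishing of the permanent and upper bounds on
-- multiplicities are carried along. The correct number of columns comes for free, since the list
-- version of the permanent is 0 for lists of different lengths.

private variable
  X Y : Set

-- Row expansion: sums over the choice of one list entry

pick : (X → List X → ℤ) → List X → ℤ
pick F []       = 0ℤ
pick F (x ∷ xs) = F x xs ℤ.+ pick (λ y ys → F y (x ∷ ys)) xs

pick-cong : ∀ {F G : X → List X → ℤ} xs →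
            (∀ y ys → xs ↭ y ∷ ys → F y ys ≡ G y ys) → pick F xs ≡ pick G xs
pick-cong []       F≡G = refl
pick-cong (x ∷ xs) F≡G = cong₂ ℤ._+_ (F≡G x xs ↭-refl)
  (pick-cong xs λ y ys σ → F≡G y (x ∷ ys) (↭-trans (prep x σ) (↭-swap x y ↭-refl)))

-- The hypothesis may use `xs ↭ y ∷ ys`; the length argument in `perₗ-length` depends on this.
pick-zero : ∀ {F : X → List X → ℤ} xs →
            (∀ y ys → xs ↭ y ∷ ys → F y ys ≡ 0ℤ) → pick F xs ≡ 0ℤ
pick-zero []       F≡0 = refl
pick-zero (x ∷ xs) F≡0 = cong₂ ℤ._+_ (F≡0 x xs ↭-refl)
  (pick-zero xs λ y ys σ → F≡0 y (x ∷ ys) (↭-trans (prep x σ) (↭-swap x y ↭-refl)))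

pick-+ : ∀ (F G : X → List X → ℤ) xs →
         pick (λ y ys → F y ys ℤ.+ G y ys) xs ≡ pick F xs ℤ.+ pick G xs
pick-+ F G []       = refl
pick-+ F G (x ∷ xs) = trans
  (cong (ℤ._+_ (F x xs ℤ.+ G x xs)) (pick-+ (λ y ys → F y (x ∷ ys)) (λ y ys → G y (x ∷ ys)) xs))
  (interchange (F x xs) (G x xs) _ _)
  where
  interchange : ∀ a b c d → (a ℤ.+ b) ℤ.+ (c ℤ.+ d) ≡ (a ℤ.+ c) ℤ.+ (b ℤ.+ d)
  interchange = ℤ.solve-∀

pick-* : ∀ k (F : X → List X → ℤ) xs →
         pick (λ y ys → k ℤ.* F y ys) xs ≡ k ℤ.* pick F xs
pick-* k F []       = sym (ℤ.*-zeroʳ k)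
pick-* k F (x ∷ xs) = trans
  (cong (ℤ._+_ (k ℤ.* F x xs)) (pick-* k (λ y ys → F y (x ∷ ys)) xs))
  (sym (ℤ.*-distribˡ-+ k (F x xs) _))

pick-map : ∀ (g : X → Y) F xs →
           pick F (map g xs) ≡ pick (λ y ys → F (g y) (map g ys)) xs
pick-map g F []       = refl
pick-map g F (x ∷ xs) = cong (ℤ._+_ (F (g x) (map g xs))) (pick-map g (λ y ys → F y (g x ∷ ys)) xs)

pick-↭ : ∀ {F : X → List X → ℤ} → (∀ y {ys zs} → ys ↭ zs → F y ys ≡ F y zs) →
         ∀ {xs xs′} → xs ↭ xs′ → pick F xs ≡ pick F xs′
pick-↭ F↭ _↭_.refl = refl
pick-↭ F↭ (prep x σ) =
  cong₂ ℤ._+_ (F↭ x σ) (pick-↭ (λ y → F↭ y ∘ prep x) σ)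
pick-↭ {F = F} F↭ {_ ∷ _ ∷ xs} {_ ∷ _ ∷ ys} (swap x y σ) = begin
  F x (y ∷ xs) ℤ.+ (F y (x ∷ xs) ℤ.+ pick (λ z zs → F z (x ∷ y ∷ zs)) xs)
    ≡⟨ cong₂ (λ a b → a ℤ.+ (b ℤ.+ pick (λ z zs → F z (x ∷ y ∷ zs)) xs))
             (F↭ x (prep y σ)) (F↭ y (prep x σ)) ⟩
  F x (y ∷ ys) ℤ.+ (F y (x ∷ ys) ℤ.+ pick (λ z zs → F z (x ∷ y ∷ zs)) xs)
    ≡⟨ cong (λ a → F x (y ∷ ys) ℤ.+ (F y (x ∷ ys) ℤ.+ a))
         (trans (pick-cong xs λ z zs _ → F↭ z (swap x y ↭-refl))
                (pick-↭ (λ z τ → F↭ z (prep y (prep x τ))) σ)) ⟩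
  F x (y ∷ ys) ℤ.+ (F y (x ∷ ys) ℤ.+ pick (λ z zs → F z (y ∷ x ∷ zs)) ys)
    ≡⟨ rotate (F x (y ∷ ys)) (F y (x ∷ ys)) _ ⟩
  F y (x ∷ ys) ℤ.+ (F x (y ∷ ys) ℤ.+ pick (λ z zs → F z (y ∷ x ∷ zs)) ys) ∎
  where
  open ≡-Reasoning
  rotate : ∀ a b c → a ℤ.+ (b ℤ.+ c) ≡ b ℤ.+ (a ℤ.+ c)
  rotate = ℤ.solve-∀
pick-↭ F↭ (_↭_.trans σ τ) = trans (pick-↭ F↭ σ) (pick-↭ F↭ τ)

-- Both sides range over ordered pairs of distinct positions, and swapping the pair is a reindexing.
-- The induction splits off the pairs that contain the first position. Exchange of two rows rests on
-- this.
pick-swap : ∀ (H : X → X → List X → ℤ) xs →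
            pick (λ y → pick (H y)) xs ≡ pick (λ y → pick (λ z → H z y)) xs
pick-swap H []       = refl
pick-swap H (x ∷ xs) = begin
  pick (H x) xs ℤ.+ pick (λ y ys → H y x ys ℤ.+ pick (λ z zs → H y z (x ∷ zs)) ys) xs
    ≡⟨ cong (ℤ._+_ (pick (H x) xs)) (pick-+ _ _ xs) ⟩
  pick (H x) xs ℤ.+ (pick (λ y → H y x) xs ℤ.+ pick (λ y → pick (λ z zs → H y z (x ∷ zs))) xs)
    ≡⟨ cong (λ a → pick (H x) xs ℤ.+ (pick (λ y → H y x) xs ℤ.+ a))
         (pick-swap (λ y z zs → H y z (x ∷ zs)) xs) ⟩
  pick (H x) xs ℤ.+ (pick (λ y → H y x) xs ℤ.+ pick (λ y → pick (λ z zs → H z y (x ∷ zs))) xs)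
    ≡⟨ rotate (pick (H x) xs) (pick (λ y → H y x) xs) _ ⟩
  pick (λ y → H y x) xs ℤ.+ (pick (H x) xs ℤ.+ pick (λ y → pick (λ z zs → H z y (x ∷ zs))) xs)
    ≡⟨ cong (ℤ._+_ (pick (λ y → H y x) xs)) (pick-+ _ _ xs) ⟨
  pick (λ y → H y x) xs ℤ.+ pick (λ y ys → H x y ys ℤ.+ pick (λ z zs → H z y (x ∷ zs)) ys) xs ∎
  where
  open ≡-Reasoning
  rotate : ∀ a b c → a ℤ.+ (b ℤ.+ c) ≡ b ℤ.+ (a ℤ.+ c)
  rotate = ℤ.solve-∀

-- Each of the equal copies leaves the same remaining list. Iterated over the rows at v, the factors
-- `suc k` build up d!.
pick-replicate : ∀ (F : X → List X → ℤ) k x ys →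
  pick F (replicate (suc k) x ++ ys) ≡
  ℤ.+ suc k ℤ.* F x (replicate k x ++ ys) ℤ.+ pick (λ z zs → F z (replicate (suc k) x ++ zs)) ys
pick-replicate F zero    x ys =
  cong (ℤ._+ pick (λ z zs → F z (x ∷ zs)) ys) (sym (ℤ.*-identityˡ (F x ys)))
pick-replicate F (suc k) x ys = begin
  a ℤ.+ pick (λ z zs → F z (x ∷ zs)) (replicate (suc k) x ++ ys)
    ≡⟨ cong (ℤ._+_ a) (pick-replicate (λ z zs → F z (x ∷ zs)) k x ys) ⟩
  a ℤ.+ (ℤ.+ suc k ℤ.* a ℤ.+ b)
    ≡⟨ collect a b (ℤ.+ suc k) ⟩
  (1ℤ ℤ.+ ℤ.+ suc k) ℤ.* a ℤ.+ b ∎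
  where
  open ≡-Reasoning
  a = F x (replicate (suc k) x ++ ys)
  b = pick (λ z zs → F z (replicate (suc (suc k)) x ++ zs)) ys

  collect : ∀ a b c → a ℤ.+ (c ℤ.* a ℤ.+ b) ≡ (1ℤ ℤ.+ c) ℤ.* a ℤ.+ b
  collect = ℤ.solve-∀

-- Expansion of `per` along its first row

sumℤ : List ℤ → ℤ
sumℤ = foldr ℤ._+_ 0ℤ

sumℤ-++ : ∀ xs ys → sumℤ (xs ++ ys) ≡ sumℤ xs ℤ.+ sumℤ ys
sumℤ-++ []       ys = sym (ℤ.+-identityˡ (sumℤ ys))
sumℤ-++ (x ∷ xs) ys = trans (cong (ℤ._+_ x) (sumℤ-++ xs ys)) (sym (ℤ.+-assoc x _ _))

sumℤ-map-* : ∀ k (f : X → ℤ) xs → sumℤ (map (λ x → k ℤ.* f x) xs) ≡ k ℤ.* sumℤ (map f xs)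
sumℤ-map-* k f []       = sym (ℤ.*-zeroʳ k)
sumℤ-map-* k f (x ∷ xs) = trans (cong (ℤ._+_ (k ℤ.* f x)) (sumℤ-map-* k f xs))
  (sym (ℤ.*-distribˡ-+ k (f x) _))

sumℤ-map-map : ∀ (f : Y → ℤ) (g : X → Y) xs → sumℤ (map f (map g xs)) ≡ sumℤ (map (f ∘ g) xs)
sumℤ-map-map f g []       = refl
sumℤ-map-map f g (x ∷ xs) = cong (ℤ._+_ (f (g x))) (sumℤ-map-map f g xs)

sumℤ-concatMap : ∀ (f : Y → ℤ) (g : X → List Y) xs →
  sumℤ (map f (concatMap g xs)) ≡ sumℤ (map (λ x → sumℤ (map f (g x))) xs)
sumℤ-concatMap f g []       = refl
sumℤ-concatMap f g (x ∷ xs) = begin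
  sumℤ (map f (g x ++ concatMap g xs))
    ≡⟨ cong sumℤ (map-++ f (g x) _) ⟩
  sumℤ (map f (g x) ++ map f (concatMap g xs))
    ≡⟨ sumℤ-++ (map f (g x)) _ ⟩
  sumℤ (map f (g x)) ℤ.+ sumℤ (map f (concatMap g xs))
    ≡⟨ cong (ℤ._+_ (sumℤ (map f (g x)))) (sumℤ-concatMap f g xs) ⟩
  _ ∎
  where open ≡-Reasoning

pick-tabulate : ∀ {m} F (g : Fin (suc m) → X) →
  pick F (tabulate g) ≡ sumℤ (tabulate λ j → F (g j) (tabulate (g ∘ punchIn j)))
pick-tabulate {m = zero}  F g = refl
pick-tabulate {m = suc m} F g =
  cong (ℤ._+_ (F (g zero) (tabulate (g ∘ suc))))
       (pick-tabulate (λ y ys → F y (g zero ∷ ys)) (g ∘ suc))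

-- `permutations` is grouped by the image j of `zero`, and `insert zero j ρ` acts on the later
-- positions as ρ followed by `punchIn j`. So `M zero j` is a common factor of the j-th group.
per-expand : ∀ {m} (M : Fin (suc m) → Fin (suc m) → ℤ) →
  per M ≡ sumℤ (tabulate λ j → M zero j ℤ.* per (λ i k → M (suc i) (punchIn j k)))
per-expand {m} M = begin
  per M
    ≡⟨ sumℤ-concatMap _ (λ j → map (insert zero j) (permutations m)) (allFin (suc m)) ⟩
  sumℤ (map (λ j → sumℤ (map term (map (insert zero j) (permutations m)))) (allFin (suc m)))
    ≡⟨ cong sumℤ (map-tabulate id (λ j → sumℤ (map term (map (insert zero j) (permutations m))))) ⟩
  sumℤ (tabulate (λ j → sumℤ (map term (map (insert zero j) (permutations m)))))
    ≡⟨ cong sumℤ (tabulate-cong λ j → trans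
         (sumℤ-map-map term (insert zero j) (permutations m))
         (sumℤ-map-* (M zero j) _ (permutations m))) ⟩
  _ ∎
  where
  open ≡-Reasoning
  term : Permutation′ (suc m) → ℤ
  term σ = Prod.sum (λ i → M i (σ ⟨$⟩ʳ i))

-- Permanents indexed by lists of rows and columns

module _ {R C : Set} (A : R → C → ℤ) where
  open ≡-Reasoning

  -- This is 0 when the two lists have different lengths.
  perₗ : List R → List C → ℤ
  perₗ []       []      = 1ℤ
  perₗ []       (_ ∷ _) = 0ℤ
  perₗ (r ∷ rs) cs      = pick (λ c cs′ → A r c ℤ.* perₗ rs cs′) cs

  -- After this passage to lists, repeated columns and reorderings are handled by `replicate` and
  -- `↭` instead of by index arithmetic.
  per≡perₗ : ∀ {m} (f : Fin m → R) (g : Fin m → C) →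
             per (λ i j → A (f i) (g j)) ≡ perₗ (tabulate f) (tabulate g)
  per≡perₗ {zero}  f g = refl
  per≡perₗ {suc m} f g = begin
    per (λ i j → A (f i) (g j))
      ≡⟨ per-expand (λ i j → A (f i) (g j)) ⟩
    sumℤ (tabulate λ j → A (f zero) (g j) ℤ.* per (λ i k → A (f (suc i)) (g (punchIn j k))))
      ≡⟨ cong sumℤ (tabulate-cong λ j →
           cong (A (f zero) (g j) ℤ.*_) (per≡perₗ (f ∘ suc) (g ∘ punchIn j))) ⟩
    sumℤ (tabulate λ j → A (f zero) (g j) ℤ.* perₗ (tabulate (f ∘ suc)) (tabulate (g ∘ punchIn j)))
      ≡⟨ pick-tabulate (λ c cs → A (f zero) c ℤ.* perₗ (tabulate (f ∘ suc)) cs) g ⟨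
    perₗ (tabulate f) (tabulate g) ∎

  per-lookup≡perₗ : ∀ rs cs (eq : length rs ≡ length cs) →
    per (λ i j → A (lookup rs i) (lookup cs (cast eq j))) ≡ perₗ rs cs
  per-lookup≡perₗ rs cs eq = trans (per≡perₗ (lookup rs) (lookup cs ∘ cast eq))
    (cong₂ perₗ (tabulate-lookup rs) (tabulate-cast (length rs) eq))
    where
    tabulate-cast : ∀ m (eq : m ≡ length cs) → tabulate (lookup cs ∘ cast eq) ≡ cs
    tabulate-cast _ refl = trans (tabulate-cong λ i → cong (lookup cs) (cast-is-id refl i))
                                 (tabulate-lookup cs)

  -- Validity of the final index function is read off from this, so no column total has to be
  -- tracked during the exchanges.
  perₗ-length : ∀ rs cs → perₗ rs cs ≢ 0ℤ → length rs ≡ length cs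
  perₗ-length rs cs per≢0 with length rs ℕ.≟ length cs
  ... | yes eq = eq
  ... | no neq = ⊥-elim (per≢0 (vanish rs cs neq))
    where
    vanish : ∀ rs cs → length rs ≢ length cs → perₗ rs cs ≡ 0ℤ
    vanish []       []      neq = ⊥-elim (neq refl)
    vanish []       (_ ∷ _) neq = refl
    vanish (r ∷ rs) cs      neq = pick-zero cs λ c cs′ σ → trans
      (cong (A r c ℤ.*_) (vanish rs cs′ λ eq → neq (trans (cong suc eq) (sym (↭-length σ)))))
      (ℤ.*-zeroʳ (A r c))

  perₗ-↭ᶜ : ∀ rs {cs cs′} → cs ↭ cs′ → perₗ rs cs ≡ perₗ rs cs′
  perₗ-↭ᶜ []       {[]}    {[]}    σ = refl
  perₗ-↭ᶜ []       {[]}    {_ ∷ _} σ with () ← ↭-length σ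
  perₗ-↭ᶜ []       {_ ∷ _} {[]}    σ with () ← ↭-length σ
  perₗ-↭ᶜ []       {_ ∷ _} {_ ∷ _} σ = refl
  perₗ-↭ᶜ (r ∷ rs) σ = pick-↭ (λ c τ → cong (A r c ℤ.*_) (perₗ-↭ᶜ rs τ)) σ

  perₗ-∷-cong : ∀ r rs rs′ → (∀ cs → perₗ rs cs ≡ perₗ rs′ cs) →
                ∀ cs → perₗ (r ∷ rs) cs ≡ perₗ (r ∷ rs′) cs
  perₗ-∷-cong r rs rs′ eq cs = pick-cong cs λ c cs′ _ → cong (A r c ℤ.*_) (eq cs′)

  perₗ-swapʳ : ∀ r s rs cs → perₗ (r ∷ s ∷ rs) cs ≡ perₗ (s ∷ r ∷ rs) cs
  perₗ-swapʳ r s rs cs = begin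
    pick (λ c cs′ → A r c ℤ.* pick (λ d ds → A s d ℤ.* perₗ rs ds) cs′) cs
      ≡⟨ pick-cong cs (λ c cs′ _ → sym (pick-* (A r c) _ cs′)) ⟩
    pick (λ c → pick (λ d ds → A r c ℤ.* (A s d ℤ.* perₗ rs ds))) cs
      ≡⟨ pick-swap (λ c d ds → A r c ℤ.* (A s d ℤ.* perₗ rs ds)) cs ⟩
    pick (λ c → pick (λ d ds → A r d ℤ.* (A s c ℤ.* perₗ rs ds))) cs
      ≡⟨ pick-cong cs (λ c cs′ _ → pick-cong cs′ λ d ds _ → exchange (A r d) (A s c) (perₗ rs ds)) ⟩
    pick (λ c → pick (λ d ds → A s c ℤ.* (A r d ℤ.* perₗ rs ds))) cs
      ≡⟨ pick-cong cs (λ c cs′ _ → pick-* (A s c) _ cs′) ⟩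
    pick (λ c cs′ → A s c ℤ.* pick (λ d ds → A r d ℤ.* perₗ rs ds) cs′) cs ∎
    where
    exchange : ∀ a b c → a ℤ.* (b ℤ.* c) ≡ b ℤ.* (a ℤ.* c)
    exchange = ℤ.solve-∀

  perₗ-↭ʳ : ∀ {rs rs′} → rs ↭ rs′ → ∀ cs → perₗ rs cs ≡ perₗ rs′ cs
  perₗ-↭ʳ _↭_.refl         cs = refl
  perₗ-↭ʳ (prep {xs = rs} {ys = rs′} r σ)   cs = perₗ-∷-cong r rs rs′ (perₗ-↭ʳ σ) cs
  perₗ-↭ʳ (swap {xs = rs} {ys = rs′} r s σ) cs = trans
    (perₗ-∷-cong r (s ∷ rs) (s ∷ rs′) (perₗ-∷-cong s rs rs′ (perₗ-↭ʳ σ)) cs)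
    (perₗ-swapʳ r s rs′ cs)
  perₗ-↭ʳ (_↭_.trans σ τ)  cs = trans (perₗ-↭ʳ σ cs) (perₗ-↭ʳ τ cs)

  -- Linearity in the head column suffices, since `perₗ-↭ᶜ` brings any column to the front. In the
  -- expansion either row r takes c, or c stays at the head of what remains, which fits the
  -- induction.
  perₗ-+ : ∀ {a b c} → (∀ r → A r c ≡ A r a ℤ.+ A r b) →
           ∀ rs cs → perₗ rs (c ∷ cs) ≡ perₗ rs (a ∷ cs) ℤ.+ perₗ rs (b ∷ cs)
  perₗ-+ c≡a+b []       cs = refl
  perₗ-+ {a} {b} {c} c≡a+b (r ∷ rs) cs = begin
    A r c ℤ.* perₗ rs cs ℤ.+ pick (λ d ds → A r d ℤ.* perₗ rs (c ∷ ds)) cs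
      ≡⟨ cong₂ (λ x y → x ℤ.* perₗ rs cs ℤ.+ y) (c≡a+b r)
           (trans (pick-cong cs λ d ds _ → trans (cong (A r d ℤ.*_) (perₗ-+ c≡a+b rs ds))
                                                 (ℤ.*-distribˡ-+ (A r d) _ _))
                  (pick-+ _ _ cs)) ⟩
    (A r a ℤ.+ A r b) ℤ.* perₗ rs cs ℤ.+
      (pick (λ d ds → A r d ℤ.* perₗ rs (a ∷ ds)) cs ℤ.+ pick (λ d ds → A r d ℤ.* perₗ rs (b ∷ ds)) cs)
      ≡⟨ rearrange (A r a) (A r b) (perₗ rs cs) _ _ ⟩
    perₗ (r ∷ rs) (a ∷ cs) ℤ.+ perₗ (r ∷ rs) (b ∷ cs) ∎
    where
    rearrange : ∀ a b p x y → (a ℤ.+ b) ℤ.* p ℤ.+ (x ℤ.+ y) ≡ (a ℤ.* p ℤ.+ x) ℤ.+ (b ℤ.* p ℤ.+ y)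
    rearrange = ℤ.solve-∀

  -- Pigeonhole: each row of `rs` absorbs at most one copy of c, so some copy falls to a row of
  -- `rs′`, where its entry is 0.
  perₗ-excess : ∀ {c rs′} → All (λ r → A r c ≡ 0ℤ) rs′ → ∀ rs {k} cs → length rs ℕ.< k →
                perₗ (rs ++ rs′) (replicate k c ++ cs) ≡ 0ℤ
  perₗ-excess {c} zs [] {suc k} cs _ = vanish zs cs
    where
    vanish : ∀ {rs} → All (λ r → A r c ≡ 0ℤ) rs → ∀ cs →
             perₗ rs (replicate (suc k) c ++ cs) ≡ 0ℤ
    vanish []                   cs = refl
    vanish {r ∷ rs} (Arc≡0 ∷ zs) cs = begin
      perₗ (r ∷ rs) (replicate (suc k) c ++ cs)
        ≡⟨ pick-replicate (λ d ds → A r d ℤ.* perₗ rs ds) k c cs ⟩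
      ℤ.+ suc k ℤ.* (A r c ℤ.* perₗ rs (replicate k c ++ cs)) ℤ.+
        pick (λ d ds → A r d ℤ.* perₗ rs (replicate (suc k) c ++ ds)) cs
        ≡⟨ cong₂ (λ x y → ℤ.+ suc k ℤ.* (x ℤ.* perₗ rs (replicate k c ++ cs)) ℤ.+ y) Arc≡0
             (pick-zero cs λ d ds _ → trans (cong (A r d ℤ.*_) (vanish zs ds)) (ℤ.*-zeroʳ (A r d))) ⟩
      ℤ.+ suc k ℤ.* (0ℤ ℤ.* perₗ rs (replicate k c ++ cs)) ℤ.+ 0ℤ
        ≡⟨ cong (ℤ._+ 0ℤ) (ℤ.*-zeroʳ (ℤ.+ suc k)) ⟩
      0ℤ ∎
  perₗ-excess {c} {rs′} zs (r ∷ rs) {suc k} cs (s≤s rs<k) = begin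
    perₗ (r ∷ rs ++ rs′) (replicate (suc k) c ++ cs)
      ≡⟨ pick-replicate (λ d ds → A r d ℤ.* perₗ (rs ++ rs′) ds) k c cs ⟩
    ℤ.+ suc k ℤ.* (A r c ℤ.* perₗ (rs ++ rs′) (replicate k c ++ cs)) ℤ.+
      pick (λ d ds → A r d ℤ.* perₗ (rs ++ rs′) (replicate (suc k) c ++ ds)) cs
      ≡⟨ cong₂ (λ x y → ℤ.+ suc k ℤ.* (A r c ℤ.* x) ℤ.+ y) (perₗ-excess zs rs cs rs<k)
           (pick-zero cs λ d ds _ → trans
             (cong (A r d ℤ.*_) (perₗ-excess zs rs ds (ℕ.m<n⇒m<1+n rs<k))) (ℤ.*-zeroʳ (A r d))) ⟩
    ℤ.+ suc k ℤ.* (A r c ℤ.* 0ℤ) ℤ.+ 0ℤ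
      ≡⟨ cong (λ x → ℤ.+ suc k ℤ.* x ℤ.+ 0ℤ) (ℤ.*-zeroʳ (A r c)) ⟩
    ℤ.+ suc k ℤ.* 0ℤ ℤ.+ 0ℤ
      ≡⟨ cong (ℤ._+ 0ℤ) (ℤ.*-zeroʳ (ℤ.+ suc k)) ⟩
    0ℤ ∎

  -- If a row of `rs` takes another column, more copies of c remain than rows that can absorb them,
  -- and `perₗ-excess` kills the term. What is left is a product of nonzero integers.
  perₗ-block : ∀ {c rs′} → All (λ r → A r c ≡ 0ℤ) rs′ → ∀ {rs} → All (λ r → A r c ≢ 0ℤ) rs →
               ∀ cs → perₗ rs′ cs ≢ 0ℤ →
               perₗ (rs ++ rs′) (replicate (length rs) c ++ cs) ≢ 0ℤ
  perₗ-block zs []                     cs per≢0 = per≢0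
  perₗ-block {c} {rs′} zs {r ∷ rs} (Arc≢0 ∷ nzs) cs per≢0 per≡0 =
    [ (λ ()) , [ Arc≢0 , perₗ-block zs nzs cs per≢0 ]′ ∘ ℤ.i*j≡0⇒i≡0∨j≡0 (A r c) ]′
      (ℤ.i*j≡0⇒i≡0∨j≡0 (ℤ.+ suc (length rs)) (trans (sym expand) per≡0))
    where
    expand : perₗ (r ∷ rs ++ rs′) (replicate (suc (length rs)) c ++ cs) ≡
             ℤ.+ suc (length rs) ℤ.* (A r c ℤ.* perₗ (rs ++ rs′) (replicate (length rs) c ++ cs))
    expand = begin
      perₗ (r ∷ rs ++ rs′) (replicate (suc (length rs)) c ++ cs)
        ≡⟨ pick-replicate (λ d ds → A r d ℤ.* perₗ (rs ++ rs′) ds) (length rs) c cs ⟩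
      lead ℤ.+ pick (λ d ds → A r d ℤ.* perₗ (rs ++ rs′) (replicate (suc (length rs)) c ++ ds)) cs
        ≡⟨ cong (ℤ._+_ lead) (pick-zero cs λ d ds _ → trans
             (cong (A r d ℤ.*_) (perₗ-excess zs rs ds (ℕ.n<1+n _))) (ℤ.*-zeroʳ (A r d))) ⟩
      lead ℤ.+ 0ℤ
        ≡⟨ ℤ.+-identityʳ lead ⟩
      lead ∎
      where
      lead = ℤ.+ suc (length rs) ℤ.* (A r c ℤ.* perₗ (rs ++ rs′) (replicate (length rs) c ++ cs))

-- The scalar s is the product of the row scalars and is the same for all column lists. A nonzero
-- permanent of `A′` thus forces a nonzero permanent of `A`, which is how the witness moves from G -
-- v into G.
perₗ-map : ∀ {R R′ C C′ : Set} (A : R → C → ℤ) (A′ : R′ → C′ → ℤ) (f : R′ → R) (g : C′ → C) →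
  (∀ r → Σ[ s ∈ ℤ ] ∀ c → A′ r c ≡ s ℤ.* A (f r) (g c)) →
  ∀ rs → Σ[ s ∈ ℤ ] ∀ cs → perₗ A′ rs cs ≡ s ℤ.* perₗ A (map f rs) (map g cs)
perₗ-map A A′ f g scaled [] = 1ℤ , λ { [] → refl ; (_ ∷ _) → refl }
perₗ-map A A′ f g scaled (r ∷ rs) with scaled r | perₗ-map A A′ f g scaled rs
... | s , s-eq | t , t-eq = s ℤ.* t , λ cs → begin
  pick (λ c cs′ → A′ r c ℤ.* perₗ A′ rs cs′) cs
    ≡⟨ pick-cong cs (λ c cs′ _ → trans (cong₂ ℤ._*_ (s-eq c) (t-eq cs′))
                                       (interchange s t (A (f r) (g c)) _)) ⟩
  pick (λ c cs′ → (s ℤ.* t) ℤ.* (A (f r) (g c) ℤ.* perₗ A (map f rs) (map g cs′))) cs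
    ≡⟨ pick-* (s ℤ.* t) _ cs ⟩
  (s ℤ.* t) ℤ.* pick (λ c cs′ → A (f r) (g c) ℤ.* perₗ A (map f rs) (map g cs′)) cs
    ≡⟨ cong (s ℤ.* t ℤ.*_) (pick-map g _ cs) ⟨
  (s ℤ.* t) ℤ.* perₗ A (f r ∷ map f rs) (map g cs) ∎
  where
  open ≡-Reasoning
  interchange : ∀ a b c d → (a ℤ.* c) ℤ.* (b ℤ.* d) ≡ (a ℤ.* b) ℤ.* (c ℤ.* d)
  interchange = ℤ.solve-∀

-- Lists up to permutation and multiplicities

unique∧set⇒↭ : {xs ys : List X} → Unique xs → Unique ys →
               (∀ {z} → z ∈ˡ xs → z ∈ˡ ys) → (∀ {z} → z ∈ˡ ys → z ∈ˡ xs) → xs ↭ ys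
unique∧set⇒↭ xs! ys! to from = ∼bag⇒↭ (unique∧set⇒bag xs! ys! (mk⇔ to from))

∈⇒↭ : ∀ {x : X} {xs} → x ∈ˡ xs → Σ[ ys ∈ List X ] xs ↭ x ∷ ys
∈⇒↭ x∈xs with ys , zs , refl ← ∈-∃++ x∈xs = ys ++ zs , shift _ ys zs

filter-split : ∀ {P : X → Set} (P? : Decidable P) xs → xs ↭ filter P? xs ++ filter (¬? ∘ P?) xs
filter-split P? []       = ↭-refl
filter-split P? (x ∷ xs) with does (P? x) | filter-split P? xs
... | true  | σ = prep x σ
... | false | σ = ↭-trans (prep x σ) (↭-sym (shift x (filter P? xs) _))

module Counting (_≟_ : DecidableEquality X) where

  δ : X → X → ℕ
  δ z x = if does (z ≟ x) then 1 else 0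

  count : X → List X → ℕ
  count z xs = sum (map (δ z) xs)

  δ-refl : ∀ z → δ z z ≡ 1
  δ-refl z with z ≟ z
  ... | yes _  = refl
  ... | no z≢z = ⊥-elim (z≢z refl)

  δ-≢ : ∀ {z x} → z ≢ x → δ z x ≡ 0
  δ-≢ {z} {x} z≢x with z ≟ x
  ... | yes z≡x = ⊥-elim (z≢x z≡x)
  ... | no _    = refl

  count-++ : ∀ z xs ys → count z (xs ++ ys) ≡ count z xs + count z ys
  count-++ z xs ys = trans (cong sum (map-++ (δ z) xs ys)) (sum-++ (map (δ z) xs) _)

  count-↭ : ∀ z {xs ys} → xs ↭ ys → count z xs ≡ count z ys
  count-↭ z σ = sum-↭ (↭-map⁺ (δ z) σ)

  count-replicate : ∀ z k x → count z (replicate k x) ≡ k * δ z x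
  count-replicate z zero    x = refl
  count-replicate z (suc k) x = cong (δ z x +_) (count-replicate z k x)

  count-∉ : ∀ {z xs} → z ∉ˡ xs → count z xs ≡ 0
  count-∉ {xs = []}     z∉ = refl
  count-∉ {xs = x ∷ xs} z∉ = cong₂ _+_ (δ-≢ (z∉ ∘ here)) (count-∉ (z∉ ∘ there))

  count-∈ : ∀ {z xs} → z ∈ˡ xs → 1 ≤ count z xs
  count-∈ {z} (here refl) = ℕ.≤-trans (ℕ.≤-reflexive (sym (δ-refl z))) (ℕ.m≤m+n _ _)
  count-∈ (there z∈xs)    = ℕ.≤-trans (count-∈ z∈xs) (ℕ.m≤n+m _ _)

  count⇒∈ : ∀ {z} xs → 1 ≤ count z xs → z ∈ˡ xs
  count⇒∈ {z} (x ∷ xs) 1≤ with z ≟ x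
  ... | yes z≡x = here z≡x
  ... | no _    = there (count⇒∈ xs 1≤)

  count-unique : ∀ {xs} → Unique xs → ∀ z → count z xs ≤ 1
  count-unique []                   z = z≤n
  count-unique {x ∷ xs} (x∉ ∷ xs!) z with z ≟ x
  ... | yes refl = s≤s (ℕ.≤-reflexive (count-∉ (All.All¬⇒¬Any x∉)))
  ... | no _     = count-unique xs! z

  -- This makes index functions and lists of columns up to order interchangeable.
  count-≗⇒↭ : ∀ xs ys → (∀ z → count z xs ≡ count z ys) → xs ↭ ys
  count-≗⇒↭ []       []       eq = ↭-refl
  count-≗⇒↭ []       (y ∷ ys) eq
    with () ← ℕ.≤-trans (count-∈ {y} {y ∷ ys} (here refl)) (ℕ.≤-reflexive (sym (eq y)))
  count-≗⇒↭ (x ∷ xs) ys       eq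
    with zs , σ ← ∈⇒↭ (count⇒∈ ys (ℕ.≤-trans (count-∈ {x} {x ∷ xs} (here refl)) (ℕ.≤-reflexive (eq x))))
    = ↭-trans (prep x (count-≗⇒↭ xs zs λ z →
        ℕ.+-cancelˡ-≡ (δ z x) _ _ (trans (eq z) (count-↭ z σ)))) (↭-sym σ)

module _ (_≟_ : DecidableEquality X) (_≟′_ : DecidableEquality Y) where
  private
    module X = Counting _≟_
    module Y = Counting _≟′_

  count-map : ∀ {f : X → Y} → (∀ {x y} → f x ≡ f y → x ≡ y) →
              ∀ z xs → Y.count (f z) (map f xs) ≡ X.count z xs
  count-map f-inj z []       = refl
  count-map {f} f-inj z (x ∷ xs) = cong₂ _+_ δ-map (count-map f-inj z xs)
    where
    δ-map : Y.δ (f z) (f x) ≡ X.δ z x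
    δ-map with z ≟ x
    ... | yes refl = Y.δ-refl (f z)
    ... | no z≢x   = Y.δ-≢ (z≢x ∘ f-inj)

length-filter-∈? : ∀ {n} (S : Subset n) → length (filter (_∈? S) (allFin n)) ≡ ∣ S ∣
length-filter-∈? {n} S = go S id λ _ → refl
  where
  -- `S` stays fixed while the recursion consumes `T`; `f` locates the positions of `T` inside `S`.
  go : ∀ {m} (T : Subset m) (f : Fin m → Fin n) → (∀ i → does (f i ∈? S) ≡ does (i ∈? T)) →
       length (filter (_∈? S) (tabulate f)) ≡ ∣ T ∣
  go []            f eq = refl
  go (outside ∷ T) f eq with does (f zero ∈? S) | eq zero
  ... | false | refl = go T (f ∘ suc) (eq ∘ suc)
  go (inside ∷ T)  f eq with does (f zero ∈? S) | eq zero
  ... | true  | refl = cong suc (go T (f ∘ suc) (eq ∘ suc))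

-- The matrix entries as differences of incidences

ι : {P : Set} → Dec P → ℤ
ι P? = if does P? then 1ℤ else 0ℤ

ι-yes : ∀ {P : Set} (P? : Dec P) → P → ι P? ≡ 1ℤ
ι-yes (yes _) p = refl
ι-yes (no ¬p) p = ⊥-elim (¬p p)

ι-no : ∀ {P : Set} (P? : Dec P) → ¬ P → ι P? ≡ 0ℤ
ι-no (yes p) ¬p = ⊥-elim (¬p p)
ι-no (no _)  ¬p = refl

ι-cong : ∀ {P Q : Set} (P? : Dec P) (Q? : Dec Q) → (P → Q) → (Q → P) → ι P? ≡ ι Q?
ι-cong (yes p) Q? f g = sym (ι-yes Q? (f p))
ι-cong (no ¬p) Q? f g = sym (ι-no Q? (¬p ∘ g))

ι-⊎ : ∀ {n} {a b w : Fin n} → a ≢ b → (P? : Dec (w ≡ a ⊎ w ≡ b)) → ι P? ≡ ι (a ≟ w) ℤ.+ ι (b ≟ w)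
ι-⊎ {a = a} {b} {w} a≢b P? with a ≟ w | b ≟ w
... | yes refl | yes refl = ⊥-elim (a≢b refl)
... | yes refl | no _     = ι-yes P? (inj₁ refl)
... | no _     | yes refl = ι-yes P? (inj₂ refl)
... | no a≢w   | no b≢w   = ι-no P? [ a≢w ∘ sym , b≢w ∘ sym ]′

if-ι : ∀ {P Q : Set} (P? : Dec P) (Q? : Dec Q) → ¬ (P × Q) →
       (if does P? then 1ℤ else if does Q? then -1ℤ else 0ℤ) ≡ ι P? ℤ.- ι Q?
if-ι (yes p) (yes q) ¬pq = ⊥-elim (¬pq (p , q))
if-ι (yes _) (no _)  ¬pq = refl
if-ι (no _)  (yes _) ¬pq = refl
if-ι (no _)  (no _)  ¬pq = refl

module _ {n} {G : Graph n} where

  _≟ᵉ_ : (y z : Element G) → Dec (y ≡ z)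
  _≟ᵉ_ = ≡-dec _≟_ _≟ₑ_

  edge-≡ : {e f : Edge G} → lo e ≡ lo f → hi e ≡ hi f → e ≡ f
  edge-≡ refl refl = refl

  ordered : ∀ (e : Edge G) → lo e Fin.< hi e
  ordered (edge u w u<w _) = recompute (u <? w) u<w

  lo≢hi : ∀ (e : Edge G) → lo e ≢ hi e
  lo≢hi e eq = <-irrefl eq (ordered e)

  endpoints-injective : ∀ {e f : Edge G} → lo e ∈ₑ f → hi e ∈ₑ f → e ≡ f
  endpoints-injective {e} {f} (inj₁ l≡l) (inj₂ h≡h) = edge-≡ l≡l h≡h
  endpoints-injective {e} {f} (inj₁ l≡l) (inj₁ h≡l) = ⊥-elim (lo≢hi e (trans l≡l (sym h≡l)))
  endpoints-injective {e} {f} (inj₂ l≡h) (inj₂ h≡h) = ⊥-elim (lo≢hi e (trans l≡h (sym h≡h)))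
  endpoints-injective {e} {f} (inj₂ l≡h) (inj₁ h≡l) = ⊥-elim (<-asym (ordered e)
    (subst₂ Fin._<_ (sym h≡l) (sym l≡h) (ordered f)))

  -- Simplicity of the graph. It excludes that both tests in the definition of `A[_]` succeed, and
  -- it makes `other` injective on the edges at v.
  two-points : ∀ {a b} {e f : Edge G} → a ≢ b → a ∈ₑ e → b ∈ₑ e → a ∈ₑ f → b ∈ₑ f → e ≡ f
  two-points a≢b (inj₁ refl) (inj₂ refl) a∈f b∈f = endpoints-injective a∈f b∈f
  two-points a≢b (inj₂ refl) (inj₁ refl) a∈f b∈f = endpoints-injective b∈f a∈f
  two-points a≢b (inj₁ refl) (inj₁ refl) a∈f b∈f = ⊥-elim (a≢b refl)
  two-points a≢b (inj₂ refl) (inj₂ refl) a∈f b∈f = ⊥-elim (a≢b refl)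

  module _ (o : Orientation G) where

    head∈ : ∀ e → head o e ∈ₑ e
    head∈ e = [ inj₂ ∘ proj₂ , inj₁ ∘ proj₂ ]′ (endpoints o e)

    tail∈ : ∀ e → tail o e ∈ₑ e
    tail∈ e = [ inj₁ ∘ proj₁ , inj₂ ∘ proj₁ ]′ (endpoints o e)

    head≢tail : ∀ e → head o e ≢ tail o e
    head≢tail e h≡t with endpoints o e
    ... | inj₁ (t≡ , h≡) = lo≢hi e (trans (sym t≡) (trans (sym h≡t) h≡))
    ... | inj₂ (t≡ , h≡) = lo≢hi e (trans (sym h≡) (trans h≡t t≡))

    ∈ₑ⇒head⊎tail : ∀ {w e} → w ∈ₑ e → w ≡ head o e ⊎ w ≡ tail o e
    ∈ₑ⇒head⊎tail {e = e} w∈e with endpoints o e | w∈e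
    ... | inj₁ (t≡ , h≡) | inj₁ w≡l = inj₂ (trans w≡l (sym t≡))
    ... | inj₁ (t≡ , h≡) | inj₂ w≡h = inj₁ (trans w≡h (sym h≡))
    ... | inj₂ (t≡ , h≡) | inj₁ w≡l = inj₁ (trans w≡l (sym h≡))
    ... | inj₂ (t≡ , h≡) | inj₂ w≡h = inj₂ (trans w≡h (sym t≡))

  -- For an edge this is written as a sum over its two ends rather than as a membership test, so
  -- that `A-edge` becomes a mere rearrangement.
  incidence : Fin n → Element G → ℤ
  incidence b (inj₁ w) = ι (w ≟ b)
  incidence b (inj₂ f) = ι (lo f ≟ b) ℤ.+ ι (hi f ≟ b)

  incidence-∈ₑ : ∀ b f → incidence b (inj₂ f) ≡ ι (b ∈ₑ? f)
  incidence-∈ₑ b f = sym (ι-⊎ (lo≢hi f) (b ∈ₑ? f))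

  -- For z = e both incidences are 1, which makes up for the exclusion of z = e in Touches.
  A-incidence : ∀ o e z → A[ o ] e z ≡ incidence (head o e) z ℤ.- incidence (tail o e) z
  A-incidence o e (inj₁ w) = if-ι (w ≟ head o e) (w ≟ tail o e)
    λ (w≡h , w≡t) → head≢tail o e (trans (sym w≡h) w≡t)
  A-incidence o e (inj₂ f) = trans
    (if-ι (touches? e (inj₂ f) (head o e)) (touches? e (inj₂ f) (tail o e))
      λ ((f≢e , h∈f) , (_ , t∈f)) →
        f≢e (two-points (head≢tail o e) h∈f t∈f (head∈ o e) (tail∈ o e)))
    (trans (difference (f ≟ₑ e))
      (cong₂ ℤ._-_ (sym (incidence-∈ₑ (head o e) f)) (sym (incidence-∈ₑ (tail o e) f))))
    where
    touch : Fin n → ℤ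
    touch b = ι (touches? e (inj₂ f) b)

    difference : Dec (f ≡ e) → touch (head o e) ℤ.- touch (tail o e) ≡
                               ι (head o e ∈ₑ? f) ℤ.- ι (tail o e ∈ₑ? f)
    difference (no f≢e) = cong₂ ℤ._-_
      (ι-cong (touches? e (inj₂ f) (head o e)) (head o e ∈ₑ? f) proj₂ (f≢e ,_))
      (ι-cong (touches? e (inj₂ f) (tail o e)) (tail o e ∈ₑ? f) proj₂ (f≢e ,_))
    difference (yes refl) = trans
      (cong₂ ℤ._-_ (ι-no (touches? e (inj₂ f) (head o e)) λ (f≢f , _) → f≢f refl)
                   (ι-no (touches? e (inj₂ f) (tail o e)) λ (f≢f , _) → f≢f refl))
      (sym (cong₂ ℤ._-_ (ι-yes (head o e ∈ₑ? f) (head∈ o e)) (ι-yes (tail o e ∈ₑ? f) (tail∈ o e))))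

  A-edge : ∀ o e f → A[ o ] e (inj₂ f) ≡ A[ o ] e (inj₁ (lo f)) ℤ.+ A[ o ] e (inj₁ (hi f))
  A-edge o e f = begin
    A[ o ] e (inj₂ f)
      ≡⟨ A-incidence o e (inj₂ f) ⟩
    (ι (lo f ≟ head o e) ℤ.+ ι (hi f ≟ head o e)) ℤ.- (ι (lo f ≟ tail o e) ℤ.+ ι (hi f ≟ tail o e))
      ≡⟨ rearrange (ι (lo f ≟ head o e)) (ι (hi f ≟ head o e)) _ _ ⟩
    (ι (lo f ≟ head o e) ℤ.- ι (lo f ≟ tail o e)) ℤ.+ (ι (hi f ≟ head o e) ℤ.- ι (hi f ≟ tail o e))
      ≡⟨ cong₂ ℤ._+_ (A-incidence o e (inj₁ (lo f))) (A-incidence o e (inj₁ (hi f))) ⟨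
    A[ o ] e (inj₁ (lo f)) ℤ.+ A[ o ] e (inj₁ (hi f)) ∎
    where
    open ≡-Reasoning
    rearrange : ∀ a b c d → (a ℤ.+ b) ℤ.- (c ℤ.+ d) ≡ (a ℤ.- c) ℤ.+ (b ℤ.- d)
    rearrange = ℤ.solve-∀

  A-∈ₑ : ∀ o {e w} → w ∈ₑ e → A[ o ] e (inj₁ w) ≢ 0ℤ
  A-∈ₑ o {e} {w} w∈e A≡0 with ∈ₑ⇒head⊎tail o {e = e} w∈e | trans (sym (A-incidence o e (inj₁ w))) A≡0
  ... | inj₁ w≡h | eq with () ← trans (sym eq) (cong₂ ℤ._-_ (ι-yes (w ≟ head o e) w≡h)
    (ι-no (w ≟ tail o e) λ w≡t → head≢tail o e (trans (sym w≡h) w≡t)))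
  ... | inj₂ w≡t | eq with () ← trans (sym eq) (cong₂ ℤ._-_
    (ι-no (w ≟ head o e) λ w≡h → head≢tail o e (trans (sym w≡h) w≡t)) (ι-yes (w ≟ tail o e) w≡t))

  A-∉ₑ : ∀ o {e w} → ¬ w ∈ₑ e → A[ o ] e (inj₁ w) ≡ 0ℤ
  A-∉ₑ o {e} {w} w∉e = trans (A-incidence o e (inj₁ w)) (cong₂ ℤ._-_
    (ι-no (w ≟ head o e) λ { refl → w∉e (head∈ o e) })
    (ι-no (w ≟ tail o e) λ { refl → w∉e (tail∈ o e) }))

  -- The orientation from `lo` to `hi` serves as a common reference. The equation `s ℤ.* s ≡ 1ℤ`
  -- allows the sign to be moved across an equation in `A-include`.
  A-signed : ∀ o e → Σ[ s ∈ ℤ ] s ℤ.* s ≡ 1ℤ ×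
             (∀ z → A[ o ] e z ≡ s ℤ.* (incidence (hi e) z ℤ.- incidence (lo e) z))
  A-signed o e with endpoints o e
  ... | inj₁ (t≡ , h≡) = 1ℤ , refl , λ z → trans (A-incidence o e z) (trans
    (cong₂ (λ h t → incidence h z ℤ.- incidence t z) h≡ t≡)
    (sym (ℤ.*-identityˡ (incidence (hi e) z ℤ.- incidence (lo e) z))))
  ... | inj₂ (t≡ , h≡) = -1ℤ , refl , λ z → trans (A-incidence o e z) (trans
    (cong₂ (λ h t → incidence h z ℤ.- incidence t z) h≡ t≡)
    (flip (incidence (lo e) z) (incidence (hi e) z)))
    where
    flip : ∀ a b → a ℤ.- b ≡ -1ℤ ℤ.* (b ℤ.- a)
    flip = ℤ.solve-∀

  -- Index functions as multiplicities of columns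

  open Counting _≟ᵉ_

  count-repeat : ∀ z η zs → count z (repeat η zs) ≡ η z * count z zs
  count-repeat z η []       = sym (ℕ.*-zeroʳ (η z))
  count-repeat z η (y ∷ zs) = begin
    count z (replicate (η y) y ++ repeat η zs)
      ≡⟨ count-++ z (replicate (η y) y) _ ⟩
    count z (replicate (η y) y) + count z (repeat η zs)
      ≡⟨ cong₂ _+_ (trans (count-replicate z (η y) y) same) (count-repeat z η zs) ⟩
    η z * δ z y + η z * count z zs
      ≡⟨ ℕ.*-distribˡ-+ (η z) (δ z y) _ ⟨
    η z * count z (y ∷ zs) ∎
    where
    open ≡-Reasoning
    same : η y * δ z y ≡ η z * δ z y
    same with z ≟ᵉ y
    ... | yes refl = refl
    ... | no _     = trans (ℕ.*-zeroʳ (η y)) (sym (ℕ.*-zeroʳ (η z)))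

  ∈-elements : ∀ z → z ∈ˡ elements G
  ∈-elements (inj₁ w) = ∈-++⁺ˡ (∈-map⁺ inj₁ (∈-allFin w))
  ∈-elements (inj₂ e) = ∈-++⁺ʳ _ (∈-map⁺ inj₂ (edges-complete G e))

  elements-unique : Unique (elements G)
  elements-unique = Unique.++⁺ (Unique.map⁺ inj₁-injective (Unique.allFin⁺ n))
                               (Unique.map⁺ inj₂-injective (edges-unique G))
                               λ (p , q) → disjoint (∈-map⁻ inj₁ p) (∈-map⁻ inj₂ q)
    where
    disjoint : ∀ {z : Element G} {xs : List (Fin n)} {ys : List (Edge G)} →
      (Σ[ x ∈ Fin n ] x ∈ˡ xs × z ≡ inj₁ x) → ¬ (Σ[ y ∈ Edge G ] y ∈ˡ ys × z ≡ inj₂ y)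
    disjoint (_ , _ , refl) (_ , _ , ())

  count-columns : ∀ z η → count z (columns η) ≡ η z
  count-columns z η = trans (count-repeat z η (elements G)) (trans
    (cong (η z *_) (ℕ.≤-antisym (count-unique elements-unique z) (count-∈ (∈-elements z))))
    (ℕ.*-identityʳ (η z)))

  per-A⟨⟩ : ∀ o η valid → per (A[ o ]⟨ η ⟩ valid) ≡ perₗ A[ o ] (edges G) (columns η)
  per-A⟨⟩ o η valid = per-lookup≡perₗ A[ o ] (edges G) (columns η)
    (sym (trans (length-repeat η (elements G)) valid))

  -- The witness is the multiplicity function of `cs`; its columns are `cs` in another order, and
  -- column order does not affect the permanent.
  nonSingular : ∀ o {η : IndexFunction G} cs → perₗ A[ o ] (edges G) cs ≢ 0ℤ →
                (∀ z → count z cs ≤ η z) → NonSingular o η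
  nonSingular o cs per≢0 bound = η″ , valid , bound , λ per≡0 → per≢0
    (trans (perₗ-↭ᶜ A[ o ] (edges G) (↭-sym σ)) (trans (sym (per-A⟨⟩ o η″ valid)) per≡0))
    where
    η″ : IndexFunction G
    η″ z = count z cs

    σ : columns η″ ↭ cs
    σ = count-≗⇒↭ (columns η″) cs λ z → count-columns z η″

    valid : Valid η″
    valid = trans (sym (length-repeat η″ (elements G)))
      (trans (↭-length σ) (sym (perₗ-length A[ o ] (edges G) cs per≢0)))

-- The edges at v and the embedding of G - v

unique-map⁺ : ∀ {X Y : Set} {f : X → Y} {xs} →
              (∀ {x y} → x ∈ˡ xs → y ∈ˡ xs → f x ≡ f y → x ≡ y) → Unique xs → Unique (map f xs)
unique-map⁺ inj []                 = []
unique-map⁺ {f = f} inj (x∉ ∷ xs!) =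
  All.map⁺ (All.tabulate λ y∈ fx≡fy → All.lookup x∉ y∈ (inj (here refl) (there y∈) fx≡fy)) ∷
  unique-map⁺ (λ x∈ y∈ → inj (there x∈) (there y∈)) xs!

module _ {n} (G : Graph (suc n)) (v : Fin (suc n)) where

  ∈-neighbours⁺ : ∀ {u} → adj G v u ≡ true → u ∈ neighbours G v
  ∈-neighbours⁺ {u} vu = lookup⇒[]= u _ (trans (lookup∘tabulate (adj G v) u) vu)

  ∈-neighbours⁻ : ∀ {u} → u ∈ neighbours G v → adj G v u ≡ true
  ∈-neighbours⁻ {u} u∈ = trans (sym (lookup∘tabulate (adj G v) u)) ([]=⇒lookup u∈)

  v∉neighbours : ¬ v ∈ neighbours G v
  v∉neighbours v∈ with () ← trans (sym (∈-neighbours⁻ v∈)) (adj-irrefl G v)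

  adjacent-ends : ∀ (e : Edge G) → adj G (lo e) (hi e) ≡ true
  adjacent-ends (edge u w _ uw) = Equivalence.to T-≡ (recompute (T? (adj G u w)) uw)

  edge-between : ∀ {u} → u ∈ neighbours G v → Σ[ e ∈ Edge G ] v ∈ₑ e × u ∈ₑ e
  edge-between {u} u∈ with <-cmp v u
  ... | tri< v<u _ _  = edge v u v<u (Equivalence.from T-≡ (∈-neighbours⁻ u∈)) , inj₁ refl , inj₂ refl
  ... | tri≈ _ refl _ = ⊥-elim (v∉neighbours u∈)
  ... | tri> _ _ u<v  =
    edge u v u<v (Equivalence.from T-≡ (trans (adj-sym G u v) (∈-neighbours⁻ u∈))) , inj₂ refl , inj₁ refl

  -- On an edge that misses v the value defaults to `lo e`. Hence `other∈` and `other≢v` hold for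
  -- every edge, whereas the lemmas that treat the value as the far end assume `v ∈ₑ e`.
  other : Edge G → Fin (suc n)
  other e = if does (v ≟ lo e) then hi e else lo e

  other∈ : ∀ e → other e ∈ₑ e
  other∈ e with v ≟ lo e
  ... | yes _ = inj₂ refl
  ... | no _  = inj₁ refl

  other≢v : ∀ e → other e ≢ v
  other≢v e o≡v with v ≟ lo e
  ... | yes v≡l = lo≢hi e (trans (sym v≡l) (sym o≡v))
  ... | no v≢l  = v≢l (sym o≡v)

  other-unique : ∀ {e u} → v ∈ₑ e → u ∈ₑ e → u ≢ v → other e ≡ u
  other-unique {e} v∈e u∈e u≢v with v ≟ lo e | v∈e | u∈e
  ... | yes v≡l | _        | inj₁ u≡l = ⊥-elim (u≢v (trans u≡l (sym v≡l)))
  ... | yes v≡l | _        | inj₂ u≡h = sym u≡h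
  ... | no v≢l  | _        | inj₁ u≡l = sym u≡l
  ... | no v≢l  | inj₁ v≡l | inj₂ u≡h = ⊥-elim (v≢l v≡l)
  ... | no v≢l  | inj₂ v≡h | inj₂ u≡h = ⊥-elim (u≢v (trans u≡h (sym v≡h)))

  other∈neighbours : ∀ {e} → v ∈ₑ e → other e ∈ neighbours G v
  other∈neighbours {e} v∈e with v ≟ lo e | v∈e
  ... | yes refl | _         = ∈-neighbours⁺ (adjacent-ends e)
  ... | no v≢l   | inj₁ v≡l  = ⊥-elim (v≢l v≡l)
  ... | no v≢l   | inj₂ refl = ∈-neighbours⁺ (trans (adj-sym G _ _) (adjacent-ends e))

  A-other : ∀ o {e} → v ∈ₑ e → ∀ r →
            A[ o ] r (inj₂ e) ≡ A[ o ] r (inj₁ (other e)) ℤ.+ A[ o ] r (inj₁ v)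
  A-other o {e} v∈e r with v ≟ lo e | v∈e
  ... | yes refl | _         = trans (A-edge o r e) (ℤ.+-comm _ (A[ o ] r (inj₁ (hi e))))
  ... | no v≢l   | inj₁ v≡l  = ⊥-elim (v≢l v≡l)
  ... | no v≢l   | inj₂ refl = A-edge o r e

  spokes : List (Edge G)
  spokes = filter (v ∈ₑ?_) (edges G)

  spokes-unique : Unique spokes
  spokes-unique = Unique.filter⁺ (v ∈ₑ?_) (edges-unique G)

  ∈-spokes⁺ : ∀ {e} → v ∈ₑ e → e ∈ˡ spokes
  ∈-spokes⁺ {e} v∈e = ∈-filter⁺ (v ∈ₑ?_) (edges-complete G e) v∈e

  ∈-spokes⁻ : ∀ {e} → e ∈ˡ spokes → v ∈ₑ e
  ∈-spokes⁻ e∈ = proj₂ (∈-filter⁻ (v ∈ₑ?_) {xs = edges G} e∈)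

  spokesTo : Subset (suc n) → List (Edge G)
  spokesTo S = filter (λ e → other e ∈? S) spokes

  -- An edge at v is determined by its far end, and each member of S is a far end. This bijection
  -- yields both the number of such edges and the multiplicities of their far ends.
  map-other-spokesTo : ∀ S → S ⊆ neighbours G v →
                       map other (spokesTo S) ↭ filter (_∈? S) (allFin (suc n))
  map-other-spokesTo S S⊆N = unique∧set⇒↭
    (unique-map⁺ other-injective (Unique.filter⁺ _ spokes-unique))
    (Unique.filter⁺ (_∈? S) (Unique.allFin⁺ (suc n))) to from
    where
    spoke⁻ : ∀ {e} → e ∈ˡ spokesTo S → v ∈ₑ e × other e ∈ S
    spoke⁻ e∈ with e∈spokes , o∈S ← ∈-filter⁻ (λ e → other e ∈? S) {xs = spokes} e∈ =
      ∈-spokes⁻ e∈spokes , o∈S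

    other-injective : ∀ {e f} → e ∈ˡ spokesTo S → f ∈ˡ spokesTo S → other e ≡ other f → e ≡ f
    other-injective {e} {f} e∈ f∈ eq = two-points (other≢v e) (other∈ e) (proj₁ (spoke⁻ e∈))
      (subst (_∈ₑ f) (sym eq) (other∈ f)) (proj₁ (spoke⁻ f∈))

    to : ∀ {u} → u ∈ˡ map other (spokesTo S) → u ∈ˡ filter (_∈? S) (allFin (suc n))
    to u∈ with e , e∈ , refl ← ∈-map⁻ other u∈ =
      ∈-filter⁺ (_∈? S) (∈-allFin (other e)) (proj₂ (spoke⁻ e∈))

    from : ∀ {u} → u ∈ˡ filter (_∈? S) (allFin (suc n)) → u ∈ˡ map other (spokesTo S)
    from {u} u∈ with u∈S ← proj₂ (∈-filter⁻ (_∈? S) {xs = allFin (suc n)} u∈)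
      with e , v∈e , u∈e ← edge-between (S⊆N u∈S)
      with refl ← other-unique {e} v∈e u∈e (λ { refl → v∉neighbours (S⊆N u∈S) }) =
      ∈-map⁺ other (∈-filter⁺ _ (∈-spokes⁺ {e} v∈e) u∈S)

  length-spokesTo : ∀ S → S ⊆ neighbours G v → length (spokesTo S) ≡ ∣ S ∣
  length-spokesTo S S⊆N = trans (sym (length-map other (spokesTo S)))
    (trans (↭-length (map-other-spokesTo S S⊆N)) (length-filter-∈? S))

  -- The case S = N(v) of `length-spokesTo`, where the filter discards nothing.
  length-spokes : length spokes ≡ degree G v
  length-spokes = trans
    (cong length (sym (filter-all (λ e → other e ∈? neighbours G v)
      (All.tabulate {xs = spokes} λ {e} e∈ → other∈neighbours {e} (∈-spokes⁻ {e} e∈)))))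
    (length-spokesTo (neighbours G v) λ u∈ → u∈)

  include : Element (G ∖ v) → Element G
  include (inj₁ u) = inj₁ (punchIn v u)
  include (inj₂ e) = inj₂ (includeEdge G v e)

  includeEdge-injective : ∀ {e f} → includeEdge G v e ≡ includeEdge G v f → e ≡ f
  includeEdge-injective eq = edge-≡ (punchIn-injective v _ _ (cong lo eq))
                                    (punchIn-injective v _ _ (cong hi eq))

  include-injective : ∀ {y z} → include y ≡ include z → y ≡ z
  include-injective {inj₁ _} {inj₁ _} eq = cong inj₁ (punchIn-injective v _ _ (inj₁-injective eq))
  include-injective {inj₂ _} {inj₂ _} eq = cong inj₂ (includeEdge-injective {_} {_} (inj₂-injective eq))

  ∉ₑ-includeEdge : ∀ e → ¬ v ∈ₑ includeEdge G v e
  ∉ₑ-includeEdge e (inj₁ v≡) = punchInᵢ≢i v (lo e) (sym v≡)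
  ∉ₑ-includeEdge e (inj₂ v≡) = punchInᵢ≢i v (hi e) (sym v≡)

  ∉ₑ⇒includeEdge : ∀ {e} → ¬ v ∈ₑ e → Σ[ e′ ∈ Edge (G ∖ v) ] e ≡ includeEdge G v e′
  ∉ₑ⇒includeEdge {e} v∉e =
    edge (punchOut v≢lo) (punchOut v≢hi) out<
      (Equivalence.from T-≡ (trans (cong₂ (adj G) lo≡ hi≡) (adjacent-ends e))) ,
    edge-≡ (sym lo≡) (sym hi≡)
    where
    v≢lo : v ≢ lo e
    v≢lo = v∉e ∘ inj₁
    v≢hi : v ≢ hi e
    v≢hi = v∉e ∘ inj₂
    lo≡ = punchIn-punchOut v≢lo
    hi≡ = punchIn-punchOut v≢hi
    out< : punchOut v≢lo Fin.< punchOut v≢hi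
    out< = ℕ.≰⇒> λ le → ℕ.<⇒≱ (ordered e)
      (subst₂ Fin._≤_ hi≡ lo≡ (punchIn-mono-≤ v _ _ le))

  -- This row order puts the support of column v in front, the shape required by `perₗ-excess` and
  -- `perₗ-block`.
  edges-split : edges G ↭ spokes ++ map (includeEdge G v) (edges (G ∖ v))
  edges-split = unique∧set⇒↭ (edges-unique G)
    (Unique.++⁺ spokes-unique (Unique.map⁺ includeEdge-injective (edges-unique (G ∖ v))) disjoint)
    (λ {e} _ → to e) λ {e} _ → edges-complete G e
    where
    disjoint : ∀ {e} → ¬ (e ∈ˡ spokes × e ∈ˡ map (includeEdge G v) (edges (G ∖ v)))
    disjoint (e∈ , e∈′) with e′ , _ , refl ← ∈-map⁻ (includeEdge G v) e∈′ =
      ∉ₑ-includeEdge e′ (∈-spokes⁻ e∈)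

    to : ∀ e → e ∈ˡ spokes ++ map (includeEdge G v) (edges (G ∖ v))
    to e with v ∈ₑ? e
    ... | yes v∈e = ∈-++⁺ˡ (∈-spokes⁺ v∈e)
    ... | no v∉e with e′ , refl ← ∉ₑ⇒includeEdge {e} v∉e =
      ∈-++⁺ʳ spokes (∈-map⁺ (includeEdge G v) (edges-complete (G ∖ v) e′))

  incidence-include : ∀ b z → incidence (punchIn v b) (include z) ≡ incidence b z
  incidence-include b (inj₁ w) = ι-punchIn w
    where
    ι-punchIn : ∀ w → ι (punchIn v w ≟ punchIn v b) ≡ ι (w ≟ b)
    ι-punchIn w = ι-cong (punchIn v w ≟ punchIn v b) (w ≟ b) (punchIn-injective v w b) (cong (punchIn v))
  incidence-include b (inj₂ f) = cong₂ ℤ._+_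
    (incidence-include b (inj₁ (lo f))) (incidence-include b (inj₁ (hi f)))

  -- The orientations `o` and `o′` are unrelated, so each row agrees only up to a sign, the product
  -- of its two signs against the reference orientation.
  A-include : ∀ o o′ r → Σ[ s ∈ ℤ ] ∀ z →
              A[ o′ ] r z ≡ s ℤ.* A[ o ] (includeEdge G v r) (include z)
  A-include o o′ r with A-signed o′ r | A-signed o (includeEdge G v r)
  ... | s , _ , A≡ | t , tt≡1 , B≡ = s ℤ.* t , λ z → let
      D = incidence (hi r) z ℤ.- incidence (lo r) z
      E = incidence (punchIn v (hi r)) (include z) ℤ.- incidence (punchIn v (lo r)) (include z)
      D≡E : D ≡ E
      D≡E = sym (cong₂ ℤ._-_ (incidence-include (hi r) z) (incidence-include (lo r) z))
    in begin
      A[ o′ ] r z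
        ≡⟨ A≡ z ⟩
      s ℤ.* D
        ≡⟨ cong (s ℤ.*_) (trans D≡E (sym (ℤ.*-identityˡ E))) ⟩
      s ℤ.* (1ℤ ℤ.* E)
        ≡⟨ cong (λ x → s ℤ.* (x ℤ.* E)) (sym tt≡1) ⟩
      s ℤ.* (t ℤ.* t ℤ.* E)
        ≡⟨ reassociate s t E ⟩
      (s ℤ.* t) ℤ.* (t ℤ.* E)
        ≡⟨ cong (s ℤ.* t ℤ.*_) (sym (B≡ (include z))) ⟩
      (s ℤ.* t) ℤ.* A[ o ] (includeEdge G v r) (include z) ∎
    where
    open ≡-Reasoning
    reassociate : ∀ s t e → s ℤ.* (t ℤ.* t ℤ.* e) ≡ (s ℤ.* t) ℤ.* (t ℤ.* e)
    reassociate = ℤ.solve-∀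

-- Exchanging columns along the edges at v

module _ {n} (G : Graph (suc n)) (v : Fin (suc n)) (o : Orientation G) (rs : List (Edge G)) where

  private
    open Counting (_≟ᵉ_ {G = G})

    A : Edge G → Element G → ℤ
    A = A[ o ]

    star : ℕ → List (Element G)
    star k = replicate k (inj₁ v)

    ends : List (Edge G) → List (Element G)
    ends = map (inj₁ ∘ other G v)

  perₗ-other : ∀ {e} → v ∈ₑ e → ∀ cs → perₗ A rs (inj₂ e ∷ cs) ≡
               perₗ A rs (inj₁ (other G v e) ∷ cs) ℤ.+ perₗ A rs (inj₁ v ∷ cs)
  perₗ-other {e} v∈e = perₗ-+ A (A-other G v o {e} v∈e) rs

  -- The second summand of perₗ-other vanishes, as it contains too many copies of v.
  replace-by-spoke : ∀ d → (∀ cs → perₗ A rs (star (suc d) ++ cs) ≡ 0ℤ) →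
    ∀ {e} → v ∈ₑ e → ∀ {cs ds} → cs ↭ inj₁ (other G v e) ∷ ds →
    perₗ A rs (star d ++ cs) ≢ 0ℤ → perₗ A rs (star d ++ inj₂ e ∷ ds) ≢ 0ℤ
  replace-by-spoke d excess {e} v∈e {cs} {ds} σ per≢0 per≡0 = per≢0 (begin
    perₗ A rs (star d ++ cs)
      ≡⟨ perₗ-↭ᶜ A rs (↭-trans (++⁺ˡ (star d) σ) (shift _ (star d) ds)) ⟩
    perₗ A rs (inj₁ (other G v e) ∷ star d ++ ds)
      ≡⟨ ℤ.+-identityʳ _ ⟨
    perₗ A rs (inj₁ (other G v e) ∷ star d ++ ds) ℤ.+ 0ℤ
      ≡⟨ cong (ℤ._+_ (perₗ A rs (inj₁ (other G v e) ∷ star d ++ ds))) (excess ds) ⟨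
    perₗ A rs (inj₁ (other G v e) ∷ star d ++ ds) ℤ.+ perₗ A rs (star (suc d) ++ ds)
      ≡⟨ perₗ-other {e} v∈e (star d ++ ds) ⟨
    perₗ A rs (inj₂ e ∷ star d ++ ds)
      ≡⟨ perₗ-↭ᶜ A rs (shift _ (star d) ds) ⟨
    perₗ A rs (star d ++ inj₂ e ∷ ds)
      ≡⟨ per≡0 ⟩
    0ℤ ∎)
    where open ≡-Reasoning

  module _ d (excess : ∀ cs → perₗ A rs (star (suc d) ++ cs) ≡ 0ℤ)
           {β γ : Element G → ℕ} (slack : ∀ w → γ (inj₁ w) ≤ β (inj₁ w)) where

    -- `es` holds the edges still to be treated. In the bound, each keeps room for itself on the
    -- left and still grants one surplus copy of its far end on the right; `γ` is room set aside for
    -- later. Once `es` is empty, the surplus is gone.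
    use-outer-spokes : ∀ {es} → All (v ∈ₑ_) es → ∀ cs → perₗ A rs (star d ++ cs) ≢ 0ℤ →
      (∀ z → count z cs + γ z + count z (map inj₂ es) ≤ β z + count z (ends es)) →
      Σ[ cs′ ∈ List (Element G) ] perₗ A rs (star d ++ cs′) ≢ 0ℤ × (∀ z → count z cs′ + γ z ≤ β z)
    use-outer-spokes [] cs per≢0 bound = cs , per≢0 , λ z →
      subst₂ _≤_ (ℕ.+-identityʳ _) (ℕ.+-identityʳ _) (bound z)
    use-outer-spokes {e ∷ es} (v∈e ∷ v∈es) cs per≢0 bound with Any.any? (inj₁ (other G v e) ≟ᵉ_) cs
    ... | yes u∈cs with ds , σ ← ∈⇒↭ u∈cs =
      use-outer-spokes v∈es (inj₂ e ∷ ds) (replace-by-spoke d excess {e} v∈e σ per≢0) λ z →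
        -- The exchange removes one u from the columns and one surplus u from the right side; adding
        -- `δ z u` back to both sides recovers the old bound.
        ℕ.+-cancelˡ-≤ (δ z u) _ _ (begin
          δ z u + (δ z (inj₂ e) + count z ds + γ z + count z (map inj₂ es))
            ≡⟨ regroup (δ z u) (δ z (inj₂ e)) (count z ds) (γ z) _ ⟩
          (δ z u + count z ds) + γ z + (δ z (inj₂ e) + count z (map inj₂ es))
            ≡⟨ cong (λ c → c + γ z + count z (map inj₂ (e ∷ es))) (count-↭ z σ) ⟨
          count z cs + γ z + count z (map inj₂ (e ∷ es))
            ≤⟨ bound z ⟩
          β z + (δ z u + count z (ends es))
            ≡⟨ exchange (β z) (δ z u) _ ⟩
          δ z u + (β z + count z (ends es)) ∎)
      where
      open ℕ.≤-Reasoning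
      u = inj₁ (other G v e)
      regroup : ∀ a b c d e → a + (b + c + d + e) ≡ (a + c) + d + (b + e)
      regroup = ℕ.solve-∀
      exchange : ∀ a b c → a + (b + c) ≡ b + (a + c)
      exchange = ℕ.solve-∀
    ... | no u∉cs = use-outer-spokes v∈es cs per≢0 bound′
      where
      open ℕ.≤-Reasoning
      u = inj₁ (other G v e)
      bound′ : ∀ z → count z cs + γ z + count z (map inj₂ es) ≤ β z + count z (ends es)
      bound′ z with z ≟ᵉ u
      ... | yes refl = begin
        count u cs + γ u + count u (map inj₂ es)
          ≡⟨ cong₂ (λ a b → a + γ u + b) (count-∉ {xs = cs} u∉cs) (count-∉ {xs = map inj₂ es} u∉es) ⟩
        γ u + 0
          ≡⟨ ℕ.+-identityʳ (γ u) ⟩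
        γ u
          ≤⟨ slack (other G v e) ⟩
        β u
          ≤⟨ ℕ.m≤m+n (β u) _ ⟩
        β u + count u (ends es) ∎
        where
        u∉es : u ∉ˡ map inj₂ es
        u∉es u∈ with () ← proj₂ (proj₂ (∈-map⁻ inj₂ u∈))
      ... | no z≢u = begin
        count z cs + γ z + count z (map inj₂ es)
          ≤⟨ ℕ.+-monoʳ-≤ (count z cs + γ z) (ℕ.m≤n+m _ (δ z (inj₂ e))) ⟩
        count z cs + γ z + count z (map inj₂ (e ∷ es))
          ≤⟨ bound z ⟩
        β z + (δ z u + count z (ends es))
          ≡⟨ cong (λ c → β z + (c + count z (ends es))) (δ-≢ z≢u) ⟩
        β z + count z (ends es) ∎

  -- Each edge e in `es` accounts for one copy of v to be spent, and the bound has room for both e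
  -- and its far end. If putting e in place of v gives permanent 0, putting the far end there gives
  -- minus the old permanent. Either way one of the two places stays empty.
  use-inner-spokes : ∀ {β : Element G → ℕ} {es} → All (v ∈ₑ_) es → ∀ cs →
    perₗ A rs (star (length es) ++ cs) ≢ 0ℤ →
    (∀ z → count z cs + (count z (map inj₂ es) + count z (ends es)) ≤ β z) →
    Σ[ cs′ ∈ List (Element G) ] perₗ A rs cs′ ≢ 0ℤ × (∀ z → count z cs′ ≤ β z)
  use-inner-spokes [] cs per≢0 bound = cs , per≢0 , λ z →
    ℕ.≤-trans (ℕ.m≤m+n _ _) (bound z)
  use-inner-spokes {β} {e ∷ es} (v∈e ∷ v∈es) cs per≢0 bound
    with perₗ A rs (inj₂ e ∷ star (length es) ++ cs) ℤ.≟ 0ℤ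
  ... | no e≢0 = use-inner-spokes v∈es (inj₂ e ∷ cs)
    (e≢0 ∘ trans (perₗ-↭ᶜ A rs (↭-sym (shift _ (star (length es)) cs)))) λ z →
      ℕ.≤-trans (ℕ.m≤m+n _ (δ z (inj₁ (other G v e)))) (ℕ.≤-trans
        (ℕ.≤-reflexive (regroup (δ z (inj₂ e)) (count z cs) (count z (map inj₂ es)) _ _)) (bound z))
    where
    regroup : ∀ a c x y b → a + c + (x + y) + b ≡ c + ((a + x) + (b + y))
    regroup = ℕ.solve-∀
  ... | yes e≡0 = use-inner-spokes v∈es (inj₁ (other G v e) ∷ cs) u≢0 λ z →
      ℕ.≤-trans (ℕ.m≤m+n _ (δ z (inj₂ e))) (ℕ.≤-trans
        (ℕ.≤-reflexive (regroup (δ z (inj₁ (other G v e))) (count z cs) (count z (map inj₂ es)) _ _)) (bound z))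
    where
    regroup : ∀ b c x y a → b + c + (x + y) + a ≡ c + ((a + x) + (b + y))
    regroup = ℕ.solve-∀

    u≢0 : perₗ A rs (star (length es) ++ inj₁ (other G v e) ∷ cs) ≢ 0ℤ
    u≢0 u≡0 = per≢0 (begin
      perₗ A rs (inj₁ v ∷ star (length es) ++ cs)
        ≡⟨ ℤ.+-identityˡ _ ⟨
      0ℤ ℤ.+ perₗ A rs (inj₁ v ∷ star (length es) ++ cs)
        ≡⟨ cong (ℤ._+ perₗ A rs (inj₁ v ∷ star (length es) ++ cs))
             (trans (perₗ-↭ᶜ A rs (↭-sym (shift _ (star (length es)) cs))) u≡0) ⟨
      perₗ A rs (inj₁ (other G v e) ∷ star (length es) ++ cs) ℤ.+
        perₗ A rs (inj₁ v ∷ star (length es) ++ cs)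
        ≡⟨ perₗ-other {e} v∈e _ ⟨
      perₗ A rs (inj₂ e ∷ star (length es) ++ cs)
        ≡⟨ e≡0 ⟩
      0ℤ ∎)
      where open ≡-Reasoning

-- Capacity bounds for the initial columns

module _ {n} (G : Graph (suc n)) (v : Fin (suc n)) (η : IndexFunction G) (S : Subset (suc n)) where

  private
    open Counting (_≟ᵉ_ {G = G})
    module Cᵥ = Counting (_≟_ {suc n})

    members : List (Fin (suc n))
    members = filter (_∈? S) (allFin (suc n))

  inner outer : List (Edge G)
  inner = spokesTo G v S
  outer = filter (λ e → ¬? (other G v e ∈? S)) (spokes G v)

  -- The final columns at v, and the room needed for turning copies of v into inner spokes.
  reserved : Element G → ℕ
  reserved z = count z (replicate (η (inj₁ v)) (inj₁ v)) ℕ.+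
               (count z (map inj₂ inner) + count z (map (inj₁ ∘ other G v) inner))

  vertex∉edges : ∀ {w : Fin (suc n)} {es : List (Edge G)} → inj₁ w ∉ˡ map inj₂ es
  vertex∉edges w∈ with () ← proj₂ (proj₂ (∈-map⁻ inj₂ w∈))

  edge∉vertices : ∀ {e : Edge G} {f : Edge G → Fin (suc n)} {es} → inj₂ e ∉ˡ map (inj₁ ∘ f) es
  edge∉vertices {f = f} e∈ with () ← proj₂ (proj₂ (∈-map⁻ (inj₁ ∘ f) e∈))

  members-∈ : ∀ {w} → w ∈ˡ members → w ∈ S
  members-∈ w∈ = proj₂ (∈-filter⁻ (_∈? S) {xs = allFin (suc n)} w∈)

  module _ (S⊆N : S ⊆ neighbours G v) (S-positive : ∀ {u} → u ∈ S → 1 ≤ η (inj₁ u)) where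

    reserved-vertex : ∀ w → reserved (inj₁ w) ≡
                      η (inj₁ v) * δ (inj₁ w) (inj₁ v) + Cᵥ.count w members
    reserved-vertex w = cong₂ _+_ (count-replicate (inj₁ w) (η (inj₁ v)) (inj₁ v))
      (cong₂ _+_ (count-∉ {xs = map inj₂ inner} vertex∉edges) (begin
        count (inj₁ w) (map (inj₁ ∘ other G v) inner)
          ≡⟨ cong (count (inj₁ w)) (map-∘ inner) ⟩
        count (inj₁ w) (map inj₁ (map (other G v) inner))
          ≡⟨ count-map _≟_ _≟ᵉ_ inj₁-injective w (map (other G v) inner) ⟩
        Cᵥ.count w (map (other G v) inner)
          ≡⟨ Cᵥ.count-↭ w (map-other-spokesTo G v S S⊆N) ⟩
        Cᵥ.count w members ∎))
      where open ≡-Reasoning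

    reserved-v : reserved (inj₁ v) ≡ η (inj₁ v)
    reserved-v = trans (reserved-vertex v) (trans
      (cong₂ (λ a b → η (inj₁ v) * a + b) (δ-refl (inj₁ v))
        (Cᵥ.count-∉ {xs = members} λ v∈ → v∉neighbours G v (S⊆N (members-∈ v∈))))
      (trans (ℕ.+-identityʳ _) (ℕ.*-identityʳ _)))

    reserved-≢v : ∀ {w} → w ≢ v → reserved (inj₁ w) ≡ Cᵥ.count w members
    reserved-≢v {w} w≢v = trans (reserved-vertex w)
      (cong (_+ Cᵥ.count w members) (trans
        (cong (η (inj₁ v) *_) (δ-≢ {inj₁ w} {inj₁ v} (w≢v ∘ inj₁-injective)))
        (ℕ.*-zeroʳ (η (inj₁ v)))))

    count-members-≤1 : ∀ w → Cᵥ.count w members ≤ 1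
    count-members-≤1 = Cᵥ.count-unique (Unique.filter⁺ (_∈? S) (Unique.allFin⁺ (suc n)))

    count-members-∉ : ∀ {w} → ¬ w ∈ S → Cᵥ.count w members ≡ 0
    count-members-∉ w∉S = Cᵥ.count-∉ {xs = members} (w∉S ∘ members-∈)

    -- Supplies `slack`: v itself reserves exactly η(v), a member of S at most one copy, which
    -- positivity on S provides, and any other vertex none.
    reserved-≤ : ∀ w → reserved (inj₁ w) ≤ η (inj₁ w)
    reserved-≤ w with w ≟ v
    ... | yes refl = ℕ.≤-reflexive reserved-v
    ... | no w≢v with w ∈? S
    ...   | yes w∈S = ℕ.≤-trans (ℕ.≤-reflexive (reserved-≢v w≢v))
                                (ℕ.≤-trans (count-members-≤1 w) (S-positive w∈S))
    ...   | no w∉S  = ℕ.≤-trans (ℕ.≤-reflexive (trans (reserved-≢v w≢v) (count-members-∉ w∉S))) z≤n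

    module _ (η-edge : ∀ (e : Edge G) → η (inj₂ e) ≡ 1) (η″ : IndexFunction (G ∖ v))
             (η″≤ : ∀ z → η″ z ≤ transfer G v η S z) where

      included : List (Element G)
      included = map (include G v) (columns η″)

      count-include : ∀ z → count (include G v z) included ≡ η″ z
      count-include z = trans (count-map _≟ᵉ_ _≟ᵉ_ (include-injective G v) z (columns η″))
                              (count-columns z η″)

      v∉included : inj₁ v ∉ˡ included
      v∉included v∈ with ∈-map⁻ (include G v) v∈
      ... | inj₁ u , _ , eq = punchInᵢ≢i v u (sym (inj₁-injective eq))

      spoke∉included : ∀ {e} → v ∈ₑ e → inj₂ e ∉ˡ included
      spoke∉included v∈e e∈ with ∈-map⁻ (include G v) e∈
      ... | inj₂ e′ , _ , refl = ∉ₑ-includeEdge G v e′ v∈e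

      outer-end : ∀ {w} → w ∈ neighbours G v → ¬ w ∈ S →
                  1 ≤ count (inj₁ w) (map (inj₁ ∘ other G v) outer)
      outer-end {w} w∈N w∉S with e , v∈e , w∈e ← edge-between G v w∈N
        with refl ← other-unique G v {e} v∈e w∈e (λ { refl → v∉neighbours G v w∈N }) =
        count-∈ (∈-map⁺ (inj₁ ∘ other G v)
          (∈-filter⁺ (λ e → ¬? (other G v e ∈? S)) (∈-spokes⁺ G v {e} v∈e) w∉S))

      -- The three cases of `transfer`: on S the unit taken away pays for the reserved copy, at a
      -- neighbour outside S the added unit is matched by the far end of an outer edge, and
      -- elsewhere nothing changes.
      vertex-bound : ∀ u → let w = punchIn v u in
        η″ (inj₁ u) + Cᵥ.count w members ≤
        η (inj₁ w) + count (inj₁ w) (map (inj₁ ∘ other G v) outer)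
      vertex-bound u with punchIn v u ∈? S | punchIn v u ∈? neighbours G v | η″≤ (inj₁ u)
      ... | yes w∈S | _ | η″≤ = begin
        η″ (inj₁ u) + Cᵥ.count (punchIn v u) members
          ≤⟨ ℕ.+-mono-≤ η″≤ (count-members-≤1 (punchIn v u)) ⟩
        η (inj₁ (punchIn v u)) ℕ.∸ 1 + 1
          -- Positivity on S ensures that the truncated subtraction loses nothing.
          ≡⟨ ℕ.m∸n+n≡m (S-positive w∈S) ⟩
        η (inj₁ (punchIn v u))
          ≤⟨ ℕ.m≤m+n _ _ ⟩
        η (inj₁ (punchIn v u)) + _ ∎
        where open ℕ.≤-Reasoning
      ... | no w∉S | yes w∈N | η″≤ = begin
        η″ (inj₁ u) + Cᵥ.count (punchIn v u) members
          ≡⟨ cong (η″ (inj₁ u) +_) (count-members-∉ w∉S) ⟩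
        η″ (inj₁ u) + 0
          ≡⟨ ℕ.+-identityʳ _ ⟩
        η″ (inj₁ u)
          ≤⟨ η″≤ ⟩
        η (inj₁ (punchIn v u)) + 1
          ≤⟨ ℕ.+-monoʳ-≤ (η (inj₁ (punchIn v u))) (outer-end w∈N w∉S) ⟩
        η (inj₁ (punchIn v u)) + _ ∎
        where open ℕ.≤-Reasoning
      ... | no w∉S | no _ | η″≤ = begin
        η″ (inj₁ u) + Cᵥ.count (punchIn v u) members
          ≡⟨ cong (η″ (inj₁ u) +_) (count-members-∉ w∉S) ⟩
        η″ (inj₁ u) + 0
          ≡⟨ ℕ.+-identityʳ _ ⟩
        η″ (inj₁ u)
          ≤⟨ η″≤ ⟩
        η (inj₁ (punchIn v u))
          ≤⟨ ℕ.m≤m+n _ _ ⟩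
        η (inj₁ (punchIn v u)) + _ ∎
        where open ℕ.≤-Reasoning

      count-spokes : ∀ e → count (inj₂ e) (map inj₂ inner) + count (inj₂ e) (map inj₂ outer) ≡
                           Counting.count _≟ₑ_ e (spokes G v)
      count-spokes e = trans
        (cong₂ _+_ (count-map _≟ₑ_ _≟ᵉ_ inj₂-injective e inner)
                     (count-map _≟ₑ_ _≟ᵉ_ inj₂-injective e outer))
        (trans (sym (Counting.count-++ _≟ₑ_ e inner outer))
          (Counting.count-↭ _≟ₑ_ e (↭-sym (filter-split (λ e → other G v e ∈? S) (spokes G v)))))

      -- The two counts are never both positive: an edge at v does not come from G - v, and any
      -- other edge is not a spoke.
      edge-bound : ∀ e → count (inj₂ e) included + Counting.count _≟ₑ_ e (spokes G v) ≤ 1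
      edge-bound e with v ∈ₑ? e
      ... | yes v∈e = ℕ.≤-trans
        (ℕ.≤-reflexive (cong (_+ Counting.count _≟ₑ_ e (spokes G v))
          (count-∉ {xs = included} (spoke∉included v∈e))))
        (Counting.count-unique _≟ₑ_ (spokes-unique G v) e)
      ... | no v∉e with e′ , refl ← ∉ₑ⇒includeEdge G v {e} v∉e = begin
        count (inj₂ e) included + Counting.count _≟ₑ_ e (spokes G v)
          ≡⟨ cong₂ _+_ (count-include (inj₂ e′))
               (Counting.count-∉ _≟ₑ_ {xs = spokes G v} (v∉e ∘ ∈-spokes⁻ G v {e})) ⟩
        η″ (inj₂ e′) + 0
          ≡⟨ ℕ.+-identityʳ _ ⟩
        η″ (inj₂ e′)
          ≤⟨ η″≤ (inj₂ e′) ⟩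
        η (inj₂ e)
          ≡⟨ η-edge e ⟩
        1 ∎
        where open ℕ.≤-Reasoning

      -- The starting invariant of `use-outer-spokes`. The d copies of v are kept outside the
      -- counted list; at v only the η(v) copies that survive to the end are charged, through
      -- `reserved`.
      initial-bound : ∀ z → count z included + reserved z + count z (map inj₂ outer) ≤
                            η z + count z (map (inj₁ ∘ other G v) outer)
      initial-bound (inj₁ w) with v ≟ w
      ... | yes refl = begin
        count (inj₁ v) included + reserved (inj₁ v) + count (inj₁ v) (map inj₂ outer)
          ≡⟨ cong₂ _+_ (cong₂ _+_ (count-∉ {xs = included} v∉included) reserved-v)
               (count-∉ {xs = map inj₂ outer} vertex∉edges) ⟩
        η (inj₁ v) + 0
          ≤⟨ ℕ.+-monoʳ-≤ (η (inj₁ v)) z≤n ⟩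
        η (inj₁ v) + _ ∎
        where open ℕ.≤-Reasoning
      ... | no v≢w = subst
        (λ w → count (inj₁ w) included + reserved (inj₁ w) + count (inj₁ w) (map inj₂ outer) ≤
               η (inj₁ w) + count (inj₁ w) (map (inj₁ ∘ other G v) outer))
        (punchIn-punchOut v≢w) (ℕ.≤-trans (ℕ.≤-reflexive count≡) (vertex-bound u))
        where
        u = punchOut v≢w
        count≡ : count (inj₁ (punchIn v u)) included + reserved (inj₁ (punchIn v u)) ℕ.+
                 count (inj₁ (punchIn v u)) (map inj₂ outer) ≡
                 η″ (inj₁ u) + Cᵥ.count (punchIn v u) members
        count≡ = trans
          (cong₂ _+_ (cong₂ _+_ (count-include (inj₁ u)) (reserved-≢v (punchInᵢ≢i v u)))
            (count-∉ {xs = map inj₂ outer} vertex∉edges))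
          (ℕ.+-identityʳ _)
      initial-bound (inj₂ e) = begin
        a + (b + (c + d)) + f
          ≡⟨ cong₂ (λ b d → a + (b + (c + d)) + f) b≡0 d≡0 ⟩
        a + (c + 0) + f
          ≡⟨ regroup a c f ⟩
        a + (c + f)
          ≡⟨ cong (a +_) (count-spokes e) ⟩
        a + Counting.count _≟ₑ_ e (spokes G v)
          ≤⟨ edge-bound e ⟩
        1
          ≡⟨ η-edge e ⟨
        η (inj₂ e)
          ≤⟨ ℕ.m≤m+n _ _ ⟩
        η (inj₂ e) + _ ∎
        where
        open ℕ.≤-Reasoning
        a = count (inj₂ e) included
        b = count (inj₂ e) (replicate (η (inj₁ v)) (inj₁ v))
        c = count (inj₂ e) (map inj₂ inner)
        d = count (inj₂ e) (map (inj₁ ∘ other G v) inner)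
        f = count (inj₂ e) (map inj₂ outer)

        b≡0 : b ≡ 0
        b≡0 = trans (count-replicate (inj₂ e) (η (inj₁ v)) (inj₁ v)) (ℕ.*-zeroʳ (η (inj₁ v)))

        d≡0 : d ≡ 0
        d≡0 = count-∉ {xs = map (inj₁ ∘ other G v) inner} edge∉vertices

        regroup : ∀ a c f → a + (c + 0) + f ≡ a + (c + f)
        regroup = ℕ.solve-∀

theorem1 : ∀ {n : ℕ} (G : Graph (suc n)) (v : Fin (suc n)) (o : Orientation G) (o′ : Orientation (G ∖ v)) (η : IndexFunction G)
    → (∀ (e : Edge G) → η (inj₂ e) ≡ 1)
    → (S : Subset (suc n))
    → S ⊆ neighbours G v
    → ∣ S ∣ + η (inj₁ v) ≡ degree G v
    → (∀ {u : Fin (suc n)} → u ∈ S → 1 ≤ η (inj₁ u))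
    → NonSingular o′ (transfer G v η S)
    → NonSingular o η
theorem1 {n} G v o o′ η η-edge S S⊆N deg S-positive (η″ , valid , η″≤ , per≢0) =
  nonSingular o cs₂ (cs₂≢0 ∘ trans (sym (perₗ-↭ʳ A[ o ] (edges-split G v) cs₂))) cs₂≤η
  where
  rows = spokes G v ++ map (includeEdge G v) (edges (G ∖ v))
  d    = length (spokes G v)
  k    = η (inj₁ v)
  cs₀  = map (include G v) (columns η″)
  star : ℕ → List (Element G)
  star j = replicate j (inj₁ v)
  open Counting (_≟ᵉ_ {G = G})

  missing : All (λ e → A[ o ] e (inj₁ v) ≡ 0ℤ) (map (includeEdge G v) (edges (G ∖ v)))
  missing = All.map⁺ (All.universal (λ e → A-∉ₑ o {includeEdge G v e} (∉ₑ-includeEdge G v e)) _)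

  incident : All (λ e → A[ o ] e (inj₁ v) ≢ 0ℤ) (spokes G v)
  incident = All.tabulate λ {e} e∈ → A-∈ₑ o {e} (∈-spokes⁻ G v {e} e∈)

  included≢0 : perₗ A[ o ] (map (includeEdge G v) (edges (G ∖ v))) cs₀ ≢ 0ℤ
  included≢0 ≡0 with s , scaled ← perₗ-map A[ o ] A[ o′ ] (includeEdge G v) (include G v)
                                    (A-include G v o o′) (edges (G ∖ v)) =
    per≢0 (trans (per-A⟨⟩ o′ η″ valid) (trans (scaled (columns η″))
      (trans (cong (s ℤ.*_) ≡0) (ℤ.*-zeroʳ s))))

  -- Taking `reserved` for `γ` preserves the room that the inner exchanges will need.
  outer-filled : Σ[ cs ∈ List (Element G) ] perₗ A[ o ] rows (star d ++ cs) ≢ 0ℤ ×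
                 (∀ z → count z cs + reserved G v η S z ≤ η z)
  outer-filled = use-outer-spokes G v o rows d
    (λ cs → perₗ-excess A[ o ] missing (spokes G v) cs (ℕ.n<1+n d))
    (reserved-≤ G v η S S⊆N S-positive)
    (All.filter⁺ _ (All.tabulate {xs = spokes G v} λ {e} → ∈-spokes⁻ G v {e}))
    cs₀ (perₗ-block A[ o ] missing incident cs₀ included≢0)
    (initial-bound G v η S S⊆N S-positive η-edge η″ η″≤)

  cs₁ = proj₁ outer-filled

  -- By d = |S| + η(v), the first |S| copies of v are the ones to be spent; the other η(v) join the
  -- final columns.
  star-split : star d ≡ star (length (spokesTo G v S)) ++ star k
  star-split = trans (cong star (trans (length-spokes G v)
      (trans (sym deg) (cong (_+ k) (sym (length-spokesTo G v S S⊆N))))))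
    (replicate-+ (length (spokesTo G v S)))
    where
    replicate-+ : ∀ i → star (i + k) ≡ star i ++ star k
    replicate-+ zero    = refl
    replicate-+ (suc i) = cong (inj₁ v ∷_) (replicate-+ i)

  filled : Σ[ cs ∈ List (Element G) ] perₗ A[ o ] rows cs ≢ 0ℤ × (∀ z → count z cs ≤ η z)
  filled = use-inner-spokes G v o rows
    (All.filter⁺ _ (All.tabulate {xs = spokes G v} λ {e} → ∈-spokes⁻ G v {e}))
    (star k ++ cs₁)
    (subst (λ cs → perₗ A[ o ] rows cs ≢ 0ℤ)
      (trans (cong (_++ cs₁) star-split) (++-assoc (star (length (spokesTo G v S))) (star k) cs₁))
      (proj₁ (proj₂ outer-filled)))
    -- The kept copies of v and the room for inner edges and their far ends together make up
    -- `reserved`.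
    λ z → ℕ.≤-trans (ℕ.≤-reflexive (trans
      (cong (_+ (count z (map inj₂ (spokesTo G v S)) + count z (map (inj₁ ∘ other G v) (spokesTo G v S))))
        (trans (count-++ z (star k) cs₁) (ℕ.+-comm _ (count z cs₁))))
      (ℕ.+-assoc (count z cs₁) _ _))) (proj₂ (proj₂ outer-filled) z)

  cs₂    = proj₁ filled
  cs₂≢0  = proj₁ (proj₂ filled)
  cs₂≤η  = proj₂ (proj₂ filled)
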